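{- Let $p$ be an odd prime and $n\ge 1$ an integer. Let $\phi:\mathbb{P}^1(\mathbb{Q})\to\mathbb{Z}/p\mathbb{Z}$ be a $\Gamma_1(p)$-invariant function (a weight-$0$ boundary symbol of level $\Gamma_1(p)$ with values in $\mathbb{Z}/p\mathbb{Z}$, evaluated at $1$) such that $$\sum_{a\in(\mathbb{Z}/p\mathbb{Z})^\times}\big(\phi(\{\infty\})-\phi(\{a/p\})\big)\not\equiv 0\pmod p.$$ Then $\lambda(\theta_{n,\phi})=p^n-1$.
   Context: For $m\ge1$ let $G_m=\mathrm{Gal}(\mathbb{Q}(\mu_{p^m})/\mathbb{Q})$, identified with $(\mathbb{Z}/p^m\mathbb{Z})^\times$ via $a\mapsto\sigma_a$, $\sigma_a(\zeta)=\zeta^a$. Let $K_n\subset\mathbb{Q}(\mu_{p^{n+1}})$ be the unique subfield of degree $p^n$ over $\mathbb{Q}$, $\mathcal{G}_n=\mathrm{Gal}(K_n/\mathbb{Q})$ (cyclic of order $p^n$), and $\pi_n:G_{n+1}\to\mathcal{G}_n$ the restriction map. For such $\phi$, the level-$n$ Mazur–Tate element $\theta_{n,\phi}\in(\mathbb{Z}/p\mathbb{Z})[\mathcal{G}_n]$ is the image under $\pi_n$ of $\sum_{a\in(\mathbb{Z}/p^{n+1}\mathbb{Z})^\times}\big(\phi(\{\infty\})-\phi(\{a/p^{n+1}\})\big)\sigma_a$. Choosing a generator $\gamma_n$ of $\mathcal{G}_n$ and setting $T=\gamma_n-1$, every $F\in(\mathbb{Z}/p\mathbb{Z})[\mathcal{G}_n]$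 is uniquely $F=\sum_{i=0}^{p^n-1}a_iT^i$ with $a_i\in\mathbb{Z}/p\mathbb{Z}$; its $\lambda$-invariant is $\lambda(F)=\min\{i:a_i\ne0\}$ ($\infty$ if $F=0$), independent of the choice of $\gamma_n$. -}

module Defs where

open import Algebra.Bundles using (CommutativeRing; Group; RawRing)
import Algebra.Definitions.RawMonoid as RawMonoidOps
import Algebra.Definitions.RawSemiring as RawSemiringOps
import Algebra.Morphism.Construct.Composition as Composition
import Algebra.Morphism.Construct.Identity as Identity
open import Algebra.Morphism.Structures using (module RingMorphisms)
open import Data.Fin.Base as Fin using (Fin; toℕ)
open import Data.Integer.Base as ℤ using (ℤ; +_; 0ℤ; 1ℤ)
open import Data.Integer.Divisibility.Signed as ℤ∣ using (_∣_; divides)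
import Data.Integer.Properties as ℤₚ
open import Data.Integer.Tactic.RingSolver using (solve-∀)
open import Data.List.Base as List using (List; []; _∷_; _++_)
open import Data.Maybe.Base using (Maybe; just; nothing)
open import Data.Nat.Base as ℕ using (ℕ; suc; NonZero)
open import Data.Nat.Coprimality using (Coprime; coprime?)
import Data.Nat.Properties as ℕₚ
open import Data.Product.Base as Product using (Σ; ∃; _×_; _,_; proj₁; proj₂)
open import Data.Rational.Base using (ℚ; 0ℚ)
import Data.Rational.Properties as ℚₚ
open import Level using (Level; _⊔_; 0ℓ) renaming (suc to lsuc)
open import Relation.Binary.PropositionalEquality as ≡ using (_≡_; refl; cong)
open import Relation.Nullary using (¬_; yes; no)

-- ℤ/mℤ is the setoid of integers under congruence; a record type, so that i, j
-- and m can be inferred from a proof.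

infix 4 _≡_[mod_]

record _≡_[mod_] (i j : ℤ) (m : ℕ) : Set where
  constructor congruent
  field
    divides-difference : (+ m) ∣ (i ℤ.- j)

module _ (m : ℕ) where

  private
    infix 4 _~_

    _~_ : ℤ → ℤ → Set
    i ~ j = i ≡ j [mod m ]

    ≡⇒~ : ∀ {i j} → i ≡ j → i ~ j
    ≡⇒~ {i} refl = congruent (divides 0ℤ (ℤₚ.+-inverseʳ i))

    recast : ∀ {i j k} → k ≡ i ℤ.- j → (+ m) ∣ k → i ~ j
    recast refl d = congruent d

    ~-sym : ∀ {i j} → i ~ j → j ~ i
    ~-sym {i} {j} (congruent d) = recast (eq i j) (ℤ∣.∣m⇒∣-m d)
      where
      eq : ∀ i j → ℤ.- (i ℤ.- j) ≡ j ℤ.- i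
      eq = solve-∀

    ~-trans : ∀ {i j k} → i ~ j → j ~ k → i ~ k
    ~-trans {i} {j} {k} (congruent d) (congruent e) =
      recast (eq i j k) (ℤ∣.∣m∣n⇒∣m+n d e)
      where
      eq : ∀ i j k → (i ℤ.- j) ℤ.+ (j ℤ.- k) ≡ i ℤ.- k
      eq = solve-∀

    +-cong : ∀ {i j k l} → i ~ j → k ~ l → (i ℤ.+ k) ~ (j ℤ.+ l)
    +-cong {i} {j} {k} {l} (congruent d) (congruent e) =
      recast (eq i j k l) (ℤ∣.∣m∣n⇒∣m+n d e)
      where
      eq : ∀ i j k l → (i ℤ.- j) ℤ.+ (k ℤ.- l) ≡ (i ℤ.+ k) ℤ.- (j ℤ.+ l)
      eq = solve-∀

    *-cong : ∀ {i j k l} → i ~ j → k ~ l → (i ℤ.* k) ~ (j ℤ.* l)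
    *-cong {i} {j} {k} {l} (congruent d) (congruent e) =
      recast (eq i j k l) (ℤ∣.∣m∣n⇒∣m+n (ℤ∣.∣m⇒∣m*n k d) (ℤ∣.∣n⇒∣m*n j e))
      where
      eq : ∀ i j k l →
           (i ℤ.- j) ℤ.* k ℤ.+ j ℤ.* (k ℤ.- l) ≡ i ℤ.* k ℤ.- j ℤ.* l
      eq = solve-∀

    neg-cong : ∀ {i j} → i ~ j → (ℤ.- i) ~ (ℤ.- j)
    neg-cong {i} {j} (congruent d) = recast (eq i j) (ℤ∣.∣m⇒∣-m d)
      where
      eq : ∀ i j → ℤ.- (i ℤ.- j) ≡ (ℤ.- i) ℤ.- (ℤ.- j)
      eq = solve-∀

  ℤ/_ : CommutativeRing 0ℓ 0ℓ
  ℤ/_ = record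
    { Carrier = ℤ ; _≈_ = _~_
    ; _+_ = ℤ._+_ ; _*_ = ℤ._*_ ; -_ = ℤ.-_ ; 0# = 0ℤ ; 1# = 1ℤ
    ; isCommutativeRing = record
      { isRing = record
        { +-isAbelianGroup = record
          { isGroup = record
            { isMonoid = record
              { isSemigroup = record
                { isMagma = record
                  { isEquivalence = record
                    { refl = ≡⇒~ refl ; sym = ~-sym ; trans = ~-trans }
                  ; ∙-cong = +-cong
                  }
                ; assoc = λ i j k → ≡⇒~ (ℤₚ.+-assoc i j k)
                }
              ; identity = (λ i → ≡⇒~ (ℤₚ.+-identityˡ i))
                         , (λ i → ≡⇒~ (ℤₚ.+-identityʳ i))
              }
            ; inverse = (λ i → ≡⇒~ (ℤₚ.+-inverseˡ i))
                      , (λ i → ≡⇒~ (ℤₚ.+-inverseʳ i))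
            ; ⁻¹-cong = neg-cong
            }
          ; comm = λ i j → ≡⇒~ (ℤₚ.+-comm i j)
          }
        ; *-cong = *-cong
        ; *-assoc = λ i j k → ≡⇒~ (ℤₚ.*-assoc i j k)
        ; *-identity = (λ i → ≡⇒~ (ℤₚ.*-identityˡ i))
                     , (λ i → ≡⇒~ (ℤₚ.*-identityʳ i))
        ; distrib = (λ i j k → ≡⇒~ (ℤₚ.*-distribˡ-+ i j k))
                  , (λ i j k → ≡⇒~ (ℤₚ.*-distribʳ-+ i j k))
        }
      ; *-comm = λ i j → ≡⇒~ (ℤₚ.*-comm i j)
      }
    }

-- (ℤ/N)ˣ, by its representatives 0 ≤ a < N.
record Unit (N : ℕ) : Set where
  constructor unit
  field
    residue : Fin N
    coprime : Coprime (toℕ residue) N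

rep : ∀ {N} → Unit N → ℕ
rep u = toℕ (Unit.residue u)

toUnit : ∀ {N} → Fin N → Maybe (Unit N)
toUnit {N} a with coprime? (toℕ a) N
... | yes cop = just (unit a cop)
... | no _    = nothing

units : (N : ℕ) → List (Unit N)
units N = List.mapMaybe toUnit (List.allFin N)

-- The point num/den of ℙ¹(ℚ), in integral homogeneous coordinates which
-- need not be coprime; points are compared by _≈ᶜ_.
record ℙ¹ℚ : Set where
  constructor [_∶_∣_]
  field
    num den : ℤ
    nonzero : ¬ (num ≡ 0ℤ × den ≡ 0ℤ)

open ℙ¹ℚ

infix 4 _≈ᶜ_

_≈ᶜ_ : ℙ¹ℚ → ℙ¹ℚ → Set
x ≈ᶜ y = num x ℤ.* den y ≡ num y ℤ.* den x

∞ᶜ : ℙ¹ℚ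
∞ᶜ = [ 1ℤ ∶ 0ℤ ∣ (λ { (() , _) }) ]

infixl 7 _/ᶜ_

_/ᶜ_ : ℤ → (m : ℕ) .{{_ : NonZero m}} → ℙ¹ℚ
a /ᶜ (suc m) = [ a ∶ + suc m ∣ (λ { (_ , ()) }) ]

record Γ₁ (N : ℕ) : Set where
  field
    a b c d : ℤ
    det : a ℤ.* d ℤ.- b ℤ.* c ≡ 1ℤ
    a≡1 : a ≡ 1ℤ [mod N ]
    d≡1 : d ≡ 1ℤ [mod N ]
    c≡0 : c ≡ 0ℤ [mod N ]

infixr 7 _•_

_•_ : ∀ {N} → Γ₁ N → ℙ¹ℚ → ℙ¹ℚ
γ • [ x ∶ y ∣ nz ] = [ a ℤ.* x ℤ.+ b ℤ.* y ∶ c ℤ.* x ℤ.+ d ℤ.* y ∣ nz′ ]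
  where
  open Γ₁ γ

  recover-x : ∀ a b c d x y →
    d ℤ.* (a ℤ.* x ℤ.+ b ℤ.* y) ℤ.- b ℤ.* (c ℤ.* x ℤ.+ d ℤ.* y)
      ≡ (a ℤ.* d ℤ.- b ℤ.* c) ℤ.* x
  recover-x = solve-∀

  recover-y : ∀ a b c d x y →
    a ℤ.* (c ℤ.* x ℤ.+ d ℤ.* y) ℤ.- c ℤ.* (a ℤ.* x ℤ.+ b ℤ.* y)
      ≡ (a ℤ.* d ℤ.- b ℤ.* c) ℤ.* y
  recover-y = solve-∀

  vanish : ∀ {u v} → u ≡ 0ℤ → v ≡ 0ℤ → ∀ s t → s ℤ.* u ℤ.- t ℤ.* v ≡ 0ℤ
  vanish refl refl = solve-∀

  by-det : ∀ z → (a ℤ.* d ℤ.- b ℤ.* c) ℤ.* z ≡ z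
  by-det z = ≡.trans (cong (ℤ._* z) det) (ℤₚ.*-identityˡ z)

  nz′ : ¬ (a ℤ.* x ℤ.+ b ℤ.* y ≡ 0ℤ × c ℤ.* x ℤ.+ d ℤ.* y ≡ 0ℤ)
  nz′ (u≡0 , v≡0) = nz
    ( ≡.trans (≡.sym (≡.trans (recover-x a b c d x y) (by-det x)))
              (vanish u≡0 v≡0 d b)
    , ≡.trans (≡.sym (≡.trans (recover-y a b c d x y) (by-det y)))
              (vanish v≡0 u≡0 a c)
    )

-- A boundary symbol of weight 0 is identified with its value at 1, a
-- Γ₁(N)-invariant function ℙ¹(ℚ) → ℤ/m.
record BoundarySymbol (N m : ℕ) : Set where
  open CommutativeRing (ℤ/ m) using (Carrier; _≈_)
  field
    φ         : ℙ¹ℚ → Carrier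
    φ-cong    : ∀ {x y} → x ≈ᶜ y → φ x ≈ φ y
    invariant : ∀ (γ : Γ₁ N) x → φ (γ • x) ≈ φ x

module GroupRing {r ℓr g ℓg} (R : CommutativeRing r ℓr) (G : Group g ℓg) where

  private
    module R = CommutativeRing R
    module G = Group G

  -- The pair (r , x) stands for the term r·[x].
  FormalSum : Set (r ⊔ g)
  FormalSum = List (R.Carrier × G.Carrier)

  infix 4 _≋_

  -- Equality in the free R-module on G: the equivalence generated by
  -- reordering terms, merging r·[x] + s·[x] = (r + s)·[x] and dropping 0·[x].
  -- This avoids assuming that equality in G or R is decidable.
  data _≋_ : FormalSum → FormalSum → Set (r ⊔ ℓr ⊔ g ⊔ ℓg) where
    ≋-refl  : ∀ {F} → F ≋ F
    ≋-sym   : ∀ {F F′} → F ≋ F′ → F′ ≋ F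
    ≋-trans : ∀ {F F′ F″} → F ≋ F′ → F′ ≋ F″ → F ≋ F″
    ≋-cons  : ∀ {r s x y F F′} → r R.≈ s → x G.≈ y → F ≋ F′ →
              (r , x) ∷ F ≋ (s , y) ∷ F′
    ≋-swap  : ∀ {t u F} → t ∷ u ∷ F ≋ u ∷ t ∷ F
    ≋-merge : ∀ {r s x F} → (r , x) ∷ (s , x) ∷ F ≋ (r R.+ s , x) ∷ F
    ≋-drop  : ∀ {x F} → (R.0# , x) ∷ F ≋ F

  scale : R.Carrier → FormalSum → FormalSum
  scale r = List.map (Product.map₁ (r R.*_))

  _⊛_ : FormalSum → FormalSum → FormalSum
  _⊛_ = List.cartesianProductWith (Product.zip R._*_ G._∙_)

  [_] : G.Carrier → FormalSum
  [ x ] = (R.1# , x) ∷ []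

  rawRing : RawRing (r ⊔ g) (r ⊔ ℓr ⊔ g ⊔ ℓg)
  rawRing = record
    { Carrier = FormalSum ; _≈_ = _≋_
    ; _+_ = _++_ ; _*_ = _⊛_ ; -_ = scale (R.- R.1#)
    ; 0# = [] ; 1# = [ G.ε ]
    }

  open RawRing rawRing public using (_+_; -_; 1#; rawSemiring; +-rawMonoid)
  open RawSemiringOps rawSemiring public using (_^_)
  open RawMonoidOps +-rawMonoid public using (sum)

pushforward : ∀ {r a b} {R : Set r} {A : Set a} {B : Set b} →
              (A → B) → List (R × A) → List (R × B)
pushforward π = List.map (Product.map₂ π)

module Powers {g ℓg} (G : Group g ℓg) where
  open Group G

  infixr 8 _↑_

  _↑_ : Carrier → ℕ → Carrier
  x ↑ k = RawMonoidOps._×_ rawMonoid k x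

  -- Nonnegative powers suffice: this is only used for finite groups.
  IsGenerator : Carrier → Set (g ⊔ ℓg)
  IsGenerator γ = ∀ x → ∃ λ k → x ≈ γ ↑ k

data ℕ∞ : Set where
  fin : ℕ → ℕ∞
  ∞   : ℕ∞

-- λ-invariants in R[G] for G cyclic of order N with generator γ, as a
-- relation between an element and its λ-invariant: when R is ℤ/p and N a power
-- of p the coefficients of an expansion in powers of T exist and are unique.
module Lambda {r ℓr g ℓg} (R : CommutativeRing r ℓr) (G : Group g ℓg)
              (N : ℕ) (γ : Group.Carrier G) where

  private
    module R = CommutativeRing R
  open GroupRing R G

  T : FormalSum
  T = [ γ ] + (- 1#)

  expansion : (Fin N → R.Carrier) → FormalSum
  expansion a = sum λ i → scale (a i) (T ^ toℕ i)

  FirstNonzero : (Fin N → R.Carrier) → ℕ∞ → Set ℓr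
  FirstNonzero a (fin m) =
    (∃ λ i → toℕ i ≡ m × ¬ (a i R.≈ R.0#)) ×
    (∀ j → toℕ j ℕ.< m → a j R.≈ R.0#)
  FirstNonzero a ∞ = ∀ j → a j R.≈ R.0#

  HasLambda : FormalSum → ℕ∞ → Set (r ⊔ ℓr ⊔ g ⊔ ℓg)
  HasLambda F l = ∃ λ a → F ≋ expansion a × FirstNonzero a l

record Extension (c ℓ : Level) : Set (lsuc (c ⊔ ℓ)) where
  field
    commutativeRing : CommutativeRing c ℓ
  open CommutativeRing commutativeRing public
  open RingMorphisms (CommutativeRing.rawRing ℚₚ.+-*-commutativeRing) rawRing
  field
    1≉0     : ¬ (1# ≈ 0#)
    inverse : ∀ x → ¬ (x ≈ 0#) → ∃ λ y → x * y ≈ 1#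
    ι       : ℚ → Carrier
    ι-homo  : IsRingHomomorphism ι

  open RawSemiringOps (RawRing.rawSemiring rawRing) public using (_^_)

  linear : ∀ {k} → (Fin k → ℚ) → (Fin k → Carrier) → Carrier
  linear q e = RawMonoidOps.sum (RawRing.+-rawMonoid rawRing) λ i → ι (q i) * e i

  record IsBasis {k} (e : Fin k → Carrier) : Set (c ⊔ ℓ) where
    field
      spanning    : ∀ x → ∃ λ q → x ≈ linear q e
      independent : ∀ q → linear q e ≈ 0# → ∀ i → q i ≡ 0ℚ

  HasDegree : ℕ → Set (c ⊔ ℓ)
  HasDegree k = Σ (Fin k → Carrier) IsBasis

module _ {c ℓ} (K : Extension c ℓ) where

  open Extension K
  open RingMorphisms rawRing rawRing

  record Automorphism : Set (c ⊔ ℓ) where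
    field
      ⟦_⟧    : Carrier → Carrier
      isIso  : IsRingIsomorphism ⟦_⟧
      fixesℚ : ∀ q → ⟦ ι q ⟧ ≈ ι q
    open IsRingIsomorphism isIso public

  open Automorphism

  private
    infix 4 _≈ᵍ_

    _≈ᵍ_ : Automorphism → Automorphism → Set (c ⊔ ℓ)
    σ ≈ᵍ τ = ∀ x → ⟦ σ ⟧ x ≈ ⟦ τ ⟧ x

    idᵍ : Automorphism
    idᵍ = record
      { ⟦_⟧ = λ x → x
      ; isIso = Identity.isRingIsomorphism rawRing (CommutativeRing.refl commutativeRing)
      ; fixesℚ = λ _ → CommutativeRing.refl commutativeRing
      }

    _∘ᵍ_ : Automorphism → Automorphism → Automorphism
    σ ∘ᵍ τ = record
      { ⟦_⟧ = λ x → ⟦ σ ⟧ (⟦ τ ⟧ x)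
      ; isIso = Composition.isRingIsomorphism (CommutativeRing.trans commutativeRing)
                  (isIso τ) (isIso σ)
      ; fixesℚ = λ q → trans (⟦⟧-cong σ (fixesℚ τ q)) (fixesℚ σ q)
      }

    module _ (σ : Automorphism) where

      inv : Carrier → Carrier
      inv x = proj₁ (surjective σ x)

      invʳ : ∀ x → ⟦ σ ⟧ (inv x) ≈ x
      invʳ x = proj₂ (surjective σ x) (CommutativeRing.refl commutativeRing)

      invˡ : ∀ x → inv (⟦ σ ⟧ x) ≈ x
      invˡ x = injective σ (invʳ (⟦ σ ⟧ x))

      unique : ∀ {x y} → ⟦ σ ⟧ y ≈ x → inv x ≈ y
      unique {x} eq = injective σ (trans (invʳ x) (sym eq))

      inv-cong : ∀ {x y} → x ≈ y → inv x ≈ inv y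
      inv-cong {y = y} eq = unique (trans (invʳ y) (sym eq))

      _⁻¹ᵍ : Automorphism
      _⁻¹ᵍ = record
        { ⟦_⟧ = inv
        ; isIso = record
          { isRingMonomorphism = record
            { isRingHomomorphism = record
              { isSemiringHomomorphism = record
                { isNearSemiringHomomorphism = record
                  { +-isMonoidHomomorphism = record
                    { isMagmaHomomorphism = record
                      { isRelHomomorphism = record { cong = inv-cong }
                      ; homo = λ x y → unique
                          (trans (+-homo σ _ _) (CommutativeRing.+-cong commutativeRing (invʳ x) (invʳ y)))
                      }
                    ; ε-homo = unique (0#-homo σ)
                    }
                  ; *-homo = λ x y → unique
                      (trans (*-homo σ _ _) (CommutativeRing.*-cong commutativeRing (invʳ x) (invʳ y)))
                  }
                ; 1#-homo = unique (1#-homo σ)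
                }
              ; -‿homo = λ x → unique
                  (trans (-‿homo σ _) (CommutativeRing.-‿cong commutativeRing (invʳ x)))
              }
            ; injective = λ {x} {y} eq →
                trans (sym (invʳ x)) (trans (⟦⟧-cong σ eq) (invʳ y))
            }
          ; surjective = λ x → ⟦ σ ⟧ x , λ eq → unique (sym eq)
          }
        ; fixesℚ = λ q → unique (fixesℚ σ q)
        }

  Gal : Group (c ⊔ ℓ) (c ⊔ ℓ)
  Gal = record
    { Carrier = Automorphism ; _≈_ = _≈ᵍ_
    ; _∙_ = _∘ᵍ_ ; ε = idᵍ ; _⁻¹ = _⁻¹ᵍ
    ; isGroup = record
      { isMonoid = record
        { isSemigroup = record
          { isMagma = record
            { isEquivalence = record
              { refl  = λ _ → CommutativeRing.refl commutativeRing
              ; sym   = λ eq x → sym (eq x)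
              ; trans = λ eq eq′ x → trans (eq x) (eq′ x)
              }
            ; ∙-cong = λ {σ} {σ′} {τ} {τ′} eq eq′ x →
                trans (⟦⟧-cong σ (eq′ x)) (eq (⟦ τ′ ⟧ x))
            }
          ; assoc = λ _ _ _ _ → CommutativeRing.refl commutativeRing
          }
        ; identity = (λ _ _ → CommutativeRing.refl commutativeRing)
                   , (λ _ _ → CommutativeRing.refl commutativeRing)
        }
      ; inverse = invˡ , invʳ
      ; ⁻¹-cong = λ {σ} {τ} eq x →
          unique σ (trans (eq _) (invʳ τ x))
      }
    }

-- L = ℚ(μ_N) with ζ a chosen generator of μ_N.
record IsCyclotomic {c ℓ} (N : ℕ) (L : Extension c ℓ) (ζ : Extension.Carrier L)
                    : Set (c ⊔ ℓ) where
  open Extension L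
  field
    root       : ζ ^ N ≈ 1#
    exactOrder : ∀ k → 0 ℕ.< k → k ℕ.< N → ¬ (ζ ^ k ≈ 1#)
    generates  : ∀ x → ∃ λ k → ∃ λ (q : Fin k → ℚ) → x ≈ linear q (λ i → ζ ^ toℕ i)

-- Injectivity is automatic, as K is a field.
record Embedding {c ℓ c′ ℓ′} (K : Extension c ℓ) (L : Extension c′ ℓ′)
                 : Set (c ⊔ ℓ ⊔ c′ ⊔ ℓ′) where
  private
    module K = Extension K
    module L = Extension L
  open RingMorphisms K.rawRing L.rawRing
  field
    ⟦_⟧  : K.Carrier → L.Carrier
    homo : IsRingHomomorphism ⟦_⟧
    overℚ : ∀ q → ⟦ K.ι q ⟧ L.≈ L.ι q

-- L = ℚ(μ_{p^(n+1)}) and its subfield K of degree p^n.  The fields σ and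
-- restrict carry the identification (ℤ/p^(n+1))ˣ ≅ Gal(L/ℚ) and the restriction
-- map Gal(L/ℚ) → Gal(K/ℚ); each is determined, up to equality of
-- automorphisms, by the equation following it.
record CyclotomicLayer (p n : ℕ) (c ℓ c′ ℓ′ : Level)
                       : Set (lsuc (c ⊔ ℓ ⊔ c′ ⊔ ℓ′)) where
  field
    L          : Extension c ℓ
    ζ          : Extension.Carrier L
    cyclotomic : IsCyclotomic (p ℕ.^ suc n) L ζ
    σ          : Unit (p ℕ.^ suc n) → Automorphism L
    K          : Extension c′ ℓ′
    degree     : Extension.HasDegree K (p ℕ.^ n)
    embedding  : Embedding K L
    restrict   : Automorphism L → Automorphism K

  private
    module L = Extension L
  open Automorphism
  open Embedding embedding renaming (⟦_⟧ to incl)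

  field
    σ-ζ        : ∀ a → ⟦ σ a ⟧ ζ L.≈ ζ L.^ rep a
    restrict-≈ : ∀ τ x → incl (⟦ restrict τ ⟧ x) L.≈ ⟦ τ ⟧ (incl x)

module _ {p : ℕ} .{{_ : NonZero p}} (Φ : BoundarySymbol p p) where

  open BoundarySymbol Φ
  open CommutativeRing (ℤ/ p)

  coefficient : (N : ℕ) .{{_ : NonZero N}} → Unit N → Carrier
  coefficient N a = φ ∞ᶜ - φ ((+ rep a) /ᶜ N)

  levelSum : Carrier
  levelSum = List.foldr _+_ 0# (List.map (coefficient p) (units p))

  module _ {c ℓ c′ ℓ′} {n : ℕ} (S : CyclotomicLayer p n c ℓ c′ ℓ′) where

    open CyclotomicLayer S

    private
      instance
        p^[n+1]≢0 : NonZero (p ℕ.^ suc n)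
        p^[n+1]≢0 = ℕₚ.m^n≢0 p (suc n)

    mazurTate : GroupRing.FormalSum (ℤ/ p) (Gal K)
    mazurTate = pushforward restrict
      (List.map (λ a → coefficient (p ℕ.^ suc n) a , σ a) (units (p ℕ.^ suc n)))

{-# OPTIONS --safe #-}

-- If c ≡ b mod p are prime to p, the cusps c/pⁿ⁺¹ and b/p are Γ₁(p)-equivalent,
-- so the coefficient of σ_c in the Mazur-Tate element depends only on c mod p.
-- A class mod p is a coset of the principal units, which map bijectively onto Gal(K/ℚ): a nontrivial principal unit has a power
-- ζ ↦ ζ ω with ω of order p, whose fixed field is spanned by the powers of ζᵖ and
-- has degree less than pⁿ, so it cannot contain K; and by Dedekind's independence
-- of characters Gal(K/ℚ) has at most pⁿ elements.  Hence the Mazur-Tate element is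
-- levelSum times the norm element Σ γⁱ, and modulo p the latter is Tᴺ⁻¹, N = pⁿ,
-- because the coefficients of (x - 1)ᴺ⁻¹ are all 1 modulo p.
module Submission where

open import Defs
open import Algebra.Bundles using (CommutativeMonoid; CommutativeRing; Group)
open import Algebra.Morphism.Structures using (module RingMorphisms)
import Algebra.Properties.CommutativeMonoid.Sum
import Algebra.Properties.CommutativeSemigroup
import Algebra.Properties.CommutativeSemiring.Exp
import Algebra.Properties.Group
import Algebra.Properties.Monoid.Mult
import Algebra.Properties.Ring
import Algebra.Properties.Semiring.Exp
import Algebra.Properties.Semiring.Sum
open import Data.Fin.Base using (Fin; zero; suc; toℕ; fromℕ; fromℕ<; inject₁; combine; cast; punchIn; punchOut; _↑ˡ_; _↑ʳ_)
open import Data.Fin.Permutation using (Permutation′; permutation; _⟨$⟩ʳ_)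
open import Data.Fin.Properties as Finₚ using (all?; any?; ¬∀⟶∃¬)
open import Data.Integer.Base as ℤ using (ℤ; +_; 0ℤ; 1ℤ)
import Data.Integer.Divisibility as ℤ∣ᵤ
import Data.Integer.Divisibility.Signed as ℤ∣
import Data.Integer.Properties as ℤₚ
import Data.Integer.Tactic.RingSolver as ℤ-Solver
open import Data.List.Base as List using (List; []; _∷_; _++_)
import Data.List.Properties as Listₚ
open import Data.Maybe.Base using (Maybe; just; nothing; maybe′)
open import Data.Nat.Base as ℕ using (ℕ; zero; suc; s≤s; z≤n; s≤s⁻¹; NonZero)
open import Data.Nat.Coprimality as Coprimality using (Coprime; coprime?)
import Data.Nat.Divisibility as ℕ∣
open import Data.Nat.DivMod as ℕ/ using (_%_)
open import Data.Nat.GCD using (module Bézout)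
open import Data.Nat.Induction using (<-rec)
open import Data.Nat.Primality as Primality using (Prime; euclidsLemma; prime⇒irreducible; prime⇒nonZero)
import Data.Nat.Properties as ℕₚ
import Data.Nat.Tactic.RingSolver as ℕ-Solver
open import Data.Product.Base as Product using (∃; ∃₂; _×_; _,_; proj₁; proj₂)
open import Data.Rational.Base as ℚ using (ℚ; 0ℚ; 1ℚ)
import Data.Rational.Properties as ℚₚ
open import Data.Sum.Base using (inj₁; inj₂; [_,_]′)
open import Function.Base using (_∘_)
open import Function.Definitions using (Injective)
open import Level using (Level)
open import Relation.Binary.Definitions using (tri<; tri≈; tri>)
open import Relation.Binary.PropositionalEquality as ≡ using (_≡_; _≢_)
import Relation.Binary.Reasoning.Setoid
open import Relation.Nullary using (¬_; Dec; yes; no)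
import Relation.Nullary.Decidable as Dec
open import Relation.Nullary.Decidable using (_×-dec_)
open import Relation.Nullary.Negation using (contradiction)

-- `L` and `K` are arbitrary models given by generators, a basis and an embedding, so counting
-- automorphisms goes through inequalities. A generator `γ` yields an injection of Gal(K/ℚ) into
-- `Fin N`, because two of any `N + 1` of its powers coincide; the units of one class mod p give `N`
-- distinct restrictions; and an injection of `Fin N` into itself is a permutation. The fixed field
-- is likewise only bounded from above: a trace followed by division by p places its elements in the
-- span of p^(n-1)(p-1) powers of ζᵖ. Equality is decided in `K`, through rational coordinates, but
-- never in `L`. Oddness of `p` enters through p-th powers of 1 + x: the quadratic coefficient
-- p(p-1)/2 has to be divisible by p for the valuation of x to grow by exactly one.

-- Linear dependence over a field with decidable zero

module LinearDependence {a ℓ} (F : CommutativeRing a ℓ)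
  (≈0? : ∀ x → Dec (CommutativeRing._≈_ F x (CommutativeRing.0# F)))
  (1≉0 : ¬ CommutativeRing._≈_ F (CommutativeRing.1# F) (CommutativeRing.0# F))
  (inverse : ∀ x → ¬ CommutativeRing._≈_ F x (CommutativeRing.0# F) →
             ∃ λ y → CommutativeRing._≈_ F (CommutativeRing._*_ F x y) (CommutativeRing.1# F))
  where

  open CommutativeRing F hiding (zero)
  open Algebra.Properties.Semiring.Sum semiring
  open Algebra.Properties.Ring ring
  open Relation.Binary.Reasoning.Setoid setoid

  Relation : ∀ {k m} → (Fin k → Fin m → Carrier) → Set _
  Relation {k} {m} A = ∃ λ (c : Fin k → Carrier) →
    (∃ λ i → ¬ (c i ≈ 0#)) × (∀ j → ∑[ i < k ] (c i * A i j) ≈ 0#)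

  -- Gaussian elimination on the rows: a vanishing row zero is itself a relation; otherwise a pivot
  -- in it clears one column, and the other rows and columns fall under induction, both numbers
  -- having dropped by one.
  dependent : ∀ {k m} → m ℕ.< k → (A : Fin k → Fin m → Carrier) → Relation A
  dependent {suc k} {m} m<k A with all? (λ j → ≈0? (A zero j))
  ... | yes A₀≈0 = e₀ , (zero , 1≉0) , λ j → begin
    1# * A zero j + ∑[ i < k ] (0# * A (suc i) j)
      ≈⟨ +-cong (trans (*-identityˡ _) (A₀≈0 j))
           (trans (sum-cong-≋ (λ i → zeroˡ (A (suc i) j))) (sum-replicate-zero k)) ⟩
    0# + 0# ≈⟨ +-identityˡ 0# ⟩
    0# ∎
    where
    e₀ : Fin (suc k) → Carrier
    e₀ zero    = 1#
    e₀ (suc _) = 0#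
  dependent {suc k} {zero} m<k A | no ¬A₀≈0 = contradiction (λ ()) ¬A₀≈0
  dependent {suc k} {suc m} m<k A | no ¬A₀≈0 = c , (suc i₀ , c′≉0) , relation
    where
    pivot = ¬∀⟶∃¬ (suc m) (λ j → A zero j ≈ 0#) (λ j → ≈0? (A zero j)) ¬A₀≈0
    j₀ = proj₁ pivot
    inv = inverse (A zero j₀) (proj₂ pivot)
    y = proj₁ inv

    f : Fin k → Carrier
    f i = - (A (suc i) j₀ * y)

    B : Fin k → Fin m → Carrier
    B i j = A (suc i) (punchIn j₀ j) + f i * A zero (punchIn j₀ j)

    IH = dependent (ℕ.s<s⁻¹ m<k) B
    c′ = proj₁ IH
    i₀ = proj₁ (proj₁ (proj₂ IH))
    c′≉0 = proj₂ (proj₁ (proj₂ IH))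

    -- A relation among the reduced rows is one among the original rows once row zero receives the
    -- sum of all its multiples that were added.
    c : Fin (suc k) → Carrier
    c zero    = ∑[ i < k ] (c′ i * f i)
    c (suc i) = c′ i

    column : ∀ j → ∑[ i < suc k ] (c i * A i j) ≈
                   ∑[ i < k ] (c′ i * (A (suc i) j + f i * A zero j))
    column j = begin
      ∑[ i < k ] (c′ i * f i) * A zero j + ∑[ i < k ] (c′ i * A (suc i) j)
        ≈⟨ +-congʳ (*-distribʳ-sum (A zero j) (λ i → c′ i * f i)) ⟩
      ∑[ i < k ] (c′ i * f i * A zero j) + ∑[ i < k ] (c′ i * A (suc i) j)
        ≈⟨ ∑-distrib-+ (λ i → c′ i * f i * A zero j) (λ i → c′ i * A (suc i) j) ⟨
      ∑[ i < k ] (c′ i * f i * A zero j + c′ i * A (suc i) j)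
        ≈⟨ sum-cong-≋ {k} (λ i → trans (+-comm _ _)
             (trans (+-congˡ (*-assoc _ _ _)) (sym (distribˡ _ _ _)))) ⟩
      ∑[ i < k ] (c′ i * (A (suc i) j + f i * A zero j)) ∎

    cancel : ∀ i → A (suc i) j₀ + f i * A zero j₀ ≈ 0#
    cancel i = begin
      x + - (x * y) * A zero j₀ ≈⟨ +-congˡ (-‿distribˡ-* _ _) ⟨
      x + - (x * y * A zero j₀) ≈⟨ +-congˡ (-‿cong (trans (*-assoc _ _ _)
                                     (trans (*-congˡ (trans (*-comm _ _) (proj₂ inv)))
                                            (*-identityʳ x)))) ⟩
      x + - x                   ≈⟨ -‿inverseʳ x ⟩
      0#                        ∎
      where x = A (suc i) j₀

    relation : ∀ j → ∑[ i < suc k ] (c i * A i j) ≈ 0#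
    relation j with j₀ Finₚ.≟ j
    ... | yes ≡.refl = trans (column j₀) (trans
            (sum-cong-≋ {k} (λ i → trans (*-congˡ (cancel i)) (zeroʳ _)))
            (sum-replicate-zero k))
    ... | no j₀≢j = ≡.subst (λ j → ∑[ i < suc k ] (c i * A i j) ≈ 0#)
            (Finₚ.punchIn-punchOut j₀≢j)
            (trans (column (punchIn j₀ (punchOut j₀≢j)))
                   (proj₂ (proj₂ IH) (punchOut j₀≢j)))

-- Principal units modulo powers of p

module Arithmetic where
  open import Data.Nat.Base using (_+_; _*_; _^_; _<_)
  open import Data.Nat.Divisibility
  open ≡ using (refl; sym; trans; cong; cong₂; subst)

  -- The binomial coefficient of k over 2, by recursion to stay free of division.
  triangle : ℕ → ℕ
  triangle zero    = 0
  triangle (suc k) = triangle k + k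

  -- The expansion is kept to second order: for `x` a multiple of p^(j+1) the cubic remainder is
  -- divisible by p^(j+3), but at j = 0 the square alone is not, so its coefficient must be known.
  [1+x]^ : ∀ x k → ∃ λ w → (1 + x) ^ k ≡ 1 + k * x + triangle k * (x * x) + w * (x * x * x)
  [1+x]^ x zero    = 0 , refl
  [1+x]^ x (suc k) with w , eq ← [1+x]^ x k =
    triangle k + w + x * w , trans (cong ((1 + x) *_) eq) (step x k (triangle k) w)
    where
    step : ∀ x k t w → (1 + x) * (1 + k * x + t * (x * x) + w * (x * x * x)) ≡
      1 + (1 + k) * x + (t + k) * (x * x) + (t + w + x * w) * (x * x * x)
    step = ℕ-Solver.solve-∀

  triangle-double : ∀ k → 2 * triangle k + k ≡ k * k
  triangle-double zero    = refl
  triangle-double (suc k) = trans (step₁ (triangle k) k)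
    (trans (cong (_+ (k + (k + 1))) (triangle-double k)) (step₂ k))
    where
    step₁ : ∀ t k → 2 * (t + k) + (1 + k) ≡ (2 * t + k) + (k + (k + 1))
    step₁ = ℕ-Solver.solve-∀
    step₂ : ∀ k → k * k + (k + (k + 1)) ≡ (1 + k) * (1 + k)
    step₂ = ℕ-Solver.solve-∀

  inverse-mod : ∀ {a m} → 1 < m → Coprime a m → ∃₂ λ x z → a * x ≡ 1 + m * z
  inverse-mod {a} {m} 1<m cop with Coprimality.coprime-Bézout cop
  ... | Bézout.+- x y eq = x , y , trans (ℕₚ.*-comm a x) (trans (sym eq) (cong suc (ℕₚ.*-comm y m)))
  -- In this sign case x a ≡ -1, so its square is ≡ 1 and x (x a) is the inverse. `1 < m` excludes x
  -- a = 0, for which the truncated `x * a ∸ 1` would give the wrong value.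
  ... | Bézout.-+ x y eq = x * (x * a) , y * (x * a ℕ.∸ 1) , square (x * a) refl
    where
    lemma : ∀ w → (1 + w) * (1 + w) + (1 + (1 + w)) ≡ 1 + (1 + (1 + w)) * w + (1 + (1 + w))
    lemma = ℕ-Solver.solve-∀
    shuffle : ∀ a x → a * (x * (x * a)) ≡ (x * a) * (x * a)
    shuffle = ℕ-Solver.solve-∀
    square : ∀ w → w ≡ x * a → a * (x * (x * a)) ≡ 1 + m * (y * (x * a ℕ.∸ 1))
    square zero    w≡ with refl ← ℕₚ.m*n≡1⇒n≡1 y m (sym (subst (λ k → 1 + k ≡ y * m) (sym w≡) eq)) =
      contradiction 1<m (ℕₚ.<-irrefl refl)
    square (suc w) w≡ = trans (shuffle a x) (trans (cong₂ _*_ (sym w≡) (sym w≡)) (trans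
      (ℕₚ.+-cancelʳ-≡ _ _ _ (lemma w))
      (cong suc (trans (cong (_* w) (trans (cong suc w≡) eq))
        (trans (reorder y m w) (cong (λ k → m * (y * (k ℕ.∸ 1))) w≡))))))
      where
      reorder : ∀ y m w → y * m * w ≡ m * (y * w)
      reorder = ℕ-Solver.solve-∀

  module _ {p : ℕ} (prime : Prime p) where

    private instance
      p≢0 : NonZero p
      p≢0 = prime⇒nonZero prime

    p∤1 : ¬ (p ∣ 1)
    p∤1 p∣1 with refl ← ∣1⇒≡1 p∣1 = Primality.¬prime[1] prime

    p∣triangle : ¬ (2 ∣ p) → p ∣ triangle p
    p∣triangle 2∤p with euclidsLemma 2 (triangle p) prime
        (∣m+n∣m⇒∣n (subst (p ∣_) (trans (sym (triangle-double p)) (ℕₚ.+-comm (2 * triangle p) p))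
          (m∣m*n p)) ∣-refl)
    ... | inj₂ p∣t = p∣t
    ... | inj₁ p∣2 with prime⇒irreducible Primality.prime[2] p∣2
    ...   | inj₁ refl = contradiction prime Primality.¬prime[1]
    ...   | inj₂ refl = contradiction ∣-refl 2∤p

    -- The terms of the expansion beyond 1 + p x are divisible by p^(j+3), the quadratic one because
    -- of `p∣triangle`. So the cofactor `u` only changes by a factor ≡ 1 mod p and stays prime to p.
    lift-exponent : ¬ (2 ∣ p) → ∀ j u → ¬ (p ∣ u) →
      ∃ λ u′ → (1 + p ^ suc j * u) ^ p ≡ 1 + p ^ suc (suc j) * u′ × ¬ (p ∣ u′)
    lift-exponent 2∤p j u p∤u
      with w , eq ← [1+x]^ (p ^ suc j * u) p | divides t tri≡ ← p∣triangle 2∤p =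
      u * (1 + p * z) ,
      trans eq (trans (cong (λ k → 1 + p * x + k * (x * x) + w * (x * x * x)) tri≡)
                      (step p (p ^ j) u t w)) ,
      [ p∤u , (λ d → p∤1 (∣m+n∣m⇒∣n (subst (p ∣_) (ℕₚ.+-comm 1 (p * z)) d) (m∣m*n z))) ]′
        ∘ euclidsLemma u (1 + p * z) prime
      where
      x = p ^ suc j * u
      z = p ^ j * u * (t + p ^ j * u * w)
      step : ∀ p q u t w → 1 + p * (p * q * u) + t * p * (p * q * u * (p * q * u)) + w *
        (p * q * u * (p * q * u) * (p * q * u))
        ≡ 1 + p * (p * q) * (u * (1 + p * (q * u * (t + q * u * w))))
      step = ℕ-Solver.solve-∀

    lift-exponents : ¬ (2 ∣ p) → ∀ r j u → ¬ (p ∣ u) →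
      ∃ λ u′ → (1 + p ^ suc j * u) ^ (p ^ r) ≡ 1 + p ^ suc (j + r) * u′ × ¬ (p ∣ u′)
    lift-exponents 2∤p zero    j u p∤u =
      u , trans (ℕₚ.*-identityʳ _) (cong (λ k → 1 + p ^ suc k * u) (sym (ℕₚ.+-identityʳ j))) , p∤u
    lift-exponents 2∤p (suc r) j u p∤u
      with u₁ , eq₁ , p∤u₁ ← lift-exponent 2∤p j u p∤u
      with u₂ , eq₂ , p∤u₂ ← lift-exponents 2∤p r (suc j) u₁ p∤u₁ =
      u₂ , trans (sym (ℕₚ.^-*-assoc _ p (p ^ r))) (trans (cong (_^ (p ^ r)) eq₁)
             (trans eq₂ (cong (λ k → 1 + p ^ suc k * u₂) (sym (ℕₚ.+-suc j r))))) , p∤u₂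

    extract-power : ∀ n y → ¬ (p ^ n ∣ y) → ∃₂ λ j u → y ≡ p ^ j * u × ¬ (p ∣ u) × j < n
    extract-power zero    y p^n∤y = contradiction (divides y (sym (ℕₚ.*-identityʳ y))) p^n∤y
    extract-power (suc n) y p^n∤y with p ∣? y
    ... | no p∤y = 0 , y , sym (ℕₚ.*-identityˡ y) , p∤y , s≤s z≤n
    ... | yes (divides z refl)
      with j , u , refl , p∤u , j<n ← extract-power n z
             (λ d → p^n∤y (subst (p ^ suc n ∣_) (ℕₚ.*-comm p z) (*-monoʳ-∣ p d))) =
      suc j , u , trans (ℕₚ.*-comm _ p) (sym (ℕₚ.*-assoc p (p ^ j) u)) , p∤u , s≤s j<n

    -- The subgroup generated by a nontrivial principal unit modulo pⁿ⁺¹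
    -- contains the one generated by 1 + pⁿ.
    power-of-1-unit : ¬ (2 ∣ p) → ∀ n y → ¬ (p ^ n ∣ y) →
      ∃₂ λ k u → (1 + p * y) ^ k ≡ 1 + p ^ n * u × ¬ (p ∣ u)
    power-of-1-unit 2∤p n y p^n∤y
      with j , u , refl , p∤u , j<n ← extract-power n y p^n∤y
      with u′ , eq , p∤u′ ← lift-exponents 2∤p (n ℕ.∸ suc j) j u p∤u =
      p ^ (n ℕ.∸ suc j) , u′ ,
      trans (cong (λ x → (1 + x) ^ (p ^ (n ℕ.∸ suc j))) (sym (ℕₚ.*-assoc p (p ^ j) u)))
        (trans eq (cong (λ k → 1 + p ^ k * u′) (ℕₚ.m+[n∸m]≡n j<n))) , p∤u′

    ∤⇒^suc∤ : ∀ n u → ¬ (p ∣ u) → ¬ (p ^ suc n ∣ p ^ n * u)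
    ∤⇒^suc∤ n u p∤u d = p∤u (*-cancelˡ-∣ (p ^ n) {{ℕₚ.m^n≢0 p n}}
      (subst (_∣ p ^ n * u) (ℕₚ.*-comm p (p ^ n)) d))

    ∤⇒coprime : ∀ {a} → ¬ (p ∣ a) → Coprime a p
    ∤⇒coprime p∤a (d∣a , d∣p) with prime⇒irreducible prime d∣p
    ... | inj₁ d≡1 = d≡1
    ... | inj₂ refl = contradiction d∣a p∤a

    ∤⇒coprime-^ : ∀ n {a} → ¬ (p ∣ a) → Coprime a (p ^ n)
    ∤⇒coprime-^ zero    p∤a (d∣a , d∣1) = ∣1⇒≡1 d∣1
    ∤⇒coprime-^ (suc n) {a} p∤a {d} (d∣a , d∣p^n) = ∤⇒coprime-^ n p∤a
      (d∣a , Coprimality.coprime-divisor d⊥p d∣p^n)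
      where
      d⊥p : Coprime d p
      d⊥p (x∣d , x∣p) = ∤⇒coprime p∤a (∣-trans x∣d d∣a , x∣p)

    coprime-^⇒∤ : ∀ n {a} → Coprime a (p ^ suc n) → ¬ (p ∣ a)
    coprime-^⇒∤ n cop p∣a with refl ← cop
      (p∣a , m∣m*n (p ^ n)) = contradiction prime Primality.¬prime[1]

    -- 1 + p y is the quotient a / a′ modulo pⁿ⁺¹, nontrivial because pⁿ ∤ y.
    quotient-unit : ∀ n {a a′ s} → Coprime a′ (p ^ suc n) → a ≡ a′ + p * s → 0 < s → s < p ^ n →
      ∃₂ λ y z → ¬ (p ^ n ∣ y) × a′ * (1 + p * y) ≡ a + p ^ suc n * z
    quotient-unit n {a} {a′} {s@(suc _)} cop a≡ 0<s s<p^n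
      with x , z , a′x≡ ← inverse-mod
        (ℕₚ.<-≤-trans (ℕ.nonTrivial⇒n>1 p {{Primality.prime⇒nonTrivial prime}})
                             (ℕₚ.m≤m*n p (p ^ n) {{ℕₚ.m^n≢0 p n}})) cop =
      -- With a′ x = 1 + pⁿ⁺¹ z the product (a′ + p s) x equals 1 + p (pⁿ z + s x). If pⁿ divided
      -- this `y`, it would divide s x a′ and hence s, which lies strictly between 0 and pⁿ.
      p ^ n * z + s * x , a * z ,
      (λ d → >⇒∤ s<p^n (∣m+n∣m⇒∣n
        (subst (p ^ n ∣_) (trans (ℕₚ.*-assoc s x a′)
          (trans (cong (s *_) (trans (ℕₚ.*-comm x a′) a′x≡)) (expand p (p ^ n) s z)))
          (∣m⇒∣m*n a′ (∣m+n∣m⇒∣n d (m∣m*n z))))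
        (∣m⇒∣m*n (s * p * z) ∣-refl))) ,
      trans (cong (a′ *_) (trans (regroup p (p ^ n) s x z)
        (trans (cong (_+ p * s * x) (sym a′x≡)) (factor a′ x (p * s)))))
        (trans (cong (λ k → a′ * (k * x)) (sym a≡))
          (trans (swap a′ a x) (trans (cong (a *_) a′x≡) (expand′ a (p ^ suc n) z))))
      where
      expand : ∀ p q s z → s * (1 + p * q * z) ≡ q * (s * p * z) + s
      expand = ℕ-Solver.solve-∀
      regroup : ∀ p q s x z → 1 + p * (q * z + s * x) ≡ 1 + p * q * z + p * s * x
      regroup = ℕ-Solver.solve-∀
      factor : ∀ a x k → a * x + k * x ≡ (a + k) * x
      factor = ℕ-Solver.solve-∀
      swap : ∀ a′ a x → a′ * (a * x) ≡ a * (a′ * x)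
      swap = ℕ-Solver.solve-∀
      expand′ : ∀ a m z → a * (1 + m * z) ≡ a + m * (a * z)
      expand′ = ℕ-Solver.solve-∀

open Arithmetic

-- Embeddings, automorphisms and Dedekind independence

module EmbeddingProperties {a ℓ a′ ℓ′} {K : Extension a ℓ} {L : Extension a′ ℓ′}
                           (E : Embedding K L) where
  private
    module K = Extension K
    module L = Extension L
  open Embedding E
  open RingMorphisms.IsRingHomomorphism homo public
  open Algebra.Properties.Semiring.Sum L.semiring using (sum-cong-≋)

  sum-homo : ∀ {k} (v : Fin k → K.Carrier) →
             ⟦ Algebra.Properties.Semiring.Sum.sum K.semiring v ⟧
               L.≈ Algebra.Properties.Semiring.Sum.sum L.semiring (λ i → ⟦ v i ⟧)
  sum-homo {zero}  v = 0#-homo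
  sum-homo {suc k} v = L.trans (+-homo _ _) (L.+-congˡ (sum-homo (λ i → v (suc i))))

  linear-homo : ∀ {k} q (e : Fin k → K.Carrier) →
                ⟦ K.linear q e ⟧ L.≈ L.linear q (λ i → ⟦ e i ⟧)
  linear-homo {k} q e = L.trans (sum-homo (λ i → K.ι (q i) K.* e i))
    (sum-cong-≋ {k} λ i → L.trans (*-homo _ _) (L.*-congʳ (overℚ (q i))))

  -- A nonzero x would have an inverse and force 1 ≈ 0 in `L`. Only the double negation results,
  -- zero in `K` being undecided at this generality; it serves to derive contradictions.
  reflects-0 : ∀ {x} → ⟦ x ⟧ L.≈ L.0# → ¬ ¬ (x K.≈ K.0#)
  reflects-0 {x} fx≈0 x≉0 with y , xy≈1 ← K.inverse x x≉0 =
    L.1≉0 (L.trans (L.sym 1#-homo) (L.trans (⟦⟧-cong (K.sym xy≈1))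
      (L.trans (*-homo x y) (L.trans (L.*-congʳ fx≈0) (L.zeroˡ _)))))

automorphism⇒embedding : ∀ {a ℓ} {K : Extension a ℓ} → Automorphism K → Embedding K K
automorphism⇒embedding σ = record
  { ⟦_⟧ = Automorphism.⟦_⟧ σ
  ; homo = Automorphism.isRingHomomorphism σ
  ; overℚ = Automorphism.fixesℚ σ
  }

module PowerProperties {g ℓg} (G : Group g ℓg) where
  open Group G
  open Powers G
  open Algebra.Properties.Group G using (∙-cancelˡ)
  open Algebra.Properties.Monoid.Mult monoid

  ε-↑ : ∀ k → ε ↑ k ≈ ε
  ε-↑ zero    = refl
  ε-↑ (suc k) = trans (identityˡ _) (ε-↑ k)

  ↑-∸ : ∀ {x i j} → i ℕ.≤ j → x ↑ i ≈ x ↑ j → x ↑ (j ℕ.∸ i) ≈ ε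
  ↑-∸ {x} {i} {j} i≤j eq = sym (∙-cancelˡ (x ↑ i) _ _ (trans (identityʳ _) (trans eq
    (trans (×-congˡ (≡.sym (ℕₚ.m+[n∸m]≡n i≤j))) (×-homo-+ x i (j ℕ.∸ i))))))

  ↑-% : ∀ {x} d .{{_ : ℕ.NonZero d}} → x ↑ d ≈ ε → ∀ k → x ↑ k ≈ x ↑ (k % d)
  ↑-% {x} d x↑d≈ε k = trans (×-congˡ (ℕ/.m≡m%n+[m/n]*n k d))
    (trans (×-homo-+ x (k % d) (k ℕ/./ d ℕ.* d))
    (trans (∙-congˡ (trans (sym (×-assocˡ x (k ℕ/./ d) d))
      (trans (×-congʳ (k ℕ/./ d) x↑d≈ε) (ε-↑ (k ℕ/./ d))))) (identityʳ _)))

module ExtensionProperties {a ℓ} (K : Extension a ℓ) where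
  open Extension K hiding (zero)
  open Algebra.Properties.Semiring.Sum semiring public
  open Algebra.Properties.Ring ring public
  module G = Group (Gal K)
  open Automorphism

  cancel-nonzero : ∀ {x y} → ¬ (y ≈ 0#) → x * y ≈ 0# → x ≈ 0#
  cancel-nonzero {x} {y} y≉0 xy≈0 with y⁻¹ , yy⁻¹≈1 ← inverse y y≉0 =
    trans (sym (*-identityʳ x)) (trans (*-congˡ (sym yy⁻¹≈1))
      (trans (sym (*-assoc x y y⁻¹)) (trans (*-congʳ xy≈0) (zeroˡ y⁻¹))))

  -- Comparing the relation at y x with f₀(y) times the relation at x eliminates f₀, which gives an
  -- induction on k. Distinctness comes with an explicit y, since the bare negation of equality does
  -- not produce one.
  automorphisms-independent : ∀ {k} (f : Fin k → Automorphism K) →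
    (∀ i j → i ≢ j → ∃ λ y → ¬ (⟦ f i ⟧ y ≈ ⟦ f j ⟧ y)) →
    (c : Fin k → Carrier) → (∀ x → ∑[ i < k ] (c i * ⟦ f i ⟧ x) ≈ 0#) →
    ∀ i → c i ≈ 0#
  automorphisms-independent {suc k} f distinct c relation = c≈0
    where
    open Relation.Binary.Reasoning.Setoid setoid

    f₀ : Carrier → Carrier
    f₀ = ⟦ f zero ⟧

    relation′ : ∀ y x →
      ∑[ i < k ] (c (suc i) * (⟦ f (suc i) ⟧ y - f₀ y) * ⟦ f (suc i) ⟧ x) ≈ 0#
    relation′ y x = begin
      ∑[ i < k ] (c (suc i) * (⟦ f (suc i) ⟧ y - f₀ y) * ⟦ f (suc i) ⟧ x)
        ≈⟨ +-identityˡ _ ⟨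
      0# + ∑[ i < k ] (c (suc i) * (⟦ f (suc i) ⟧ y - f₀ y) * ⟦ f (suc i) ⟧ x)
        ≈⟨ +-congʳ (trans (*-congʳ (trans (*-congˡ (-‿inverseʳ _)) (zeroʳ _))) (zeroˡ _)) ⟨
      ∑[ i < suc k ] (c i * (⟦ f i ⟧ y - f₀ y) * ⟦ f i ⟧ x)
        ≈⟨ sum-cong-≋ {suc k} expand ⟩
      ∑[ i < suc k ] (c i * ⟦ f i ⟧ (y * x) + - f₀ y * (c i * ⟦ f i ⟧ x))
        ≈⟨ ∑-distrib-+ {suc k} (λ i → c i * ⟦ f i ⟧ (y * x)) (λ i → - f₀ y * (c i * ⟦ f i ⟧ x)) ⟩
      ∑[ i < suc k ] (c i * ⟦ f i ⟧ (y * x)) + ∑[ i < suc k ] (- f₀ y * (c i * ⟦ f i ⟧ x))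
        ≈⟨ +-cong (relation (y * x))
          (trans (sym (*-distribˡ-sum {suc k} (- f₀ y) (λ i → c i * ⟦ f i ⟧ x)))
             (trans (*-congˡ (relation x)) (zeroʳ _))) ⟩
      0# + 0# ≈⟨ +-identityˡ 0# ⟩
      0# ∎
      where
      expand : ∀ i → c i * (⟦ f i ⟧ y - f₀ y) * ⟦ f i ⟧ x ≈
                     c i * ⟦ f i ⟧ (y * x) + - f₀ y * (c i * ⟦ f i ⟧ x)
      expand i = begin
        c i * (u - w) * v             ≈⟨ *-assoc _ _ _ ⟩
        c i * ((u - w) * v)           ≈⟨ *-congˡ (distribʳ v u (- w)) ⟩
        c i * (u * v + - w * v)       ≈⟨ distribˡ _ _ _ ⟩
        c i * (u * v) + c i * (- w * v) ≈⟨ +-cong (*-congˡ (sym (*-homo (f i) y x)))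
           (trans (sym (*-assoc _ _ _)) (trans (*-congʳ (*-comm _ _)) (*-assoc _ _ _))) ⟩
        c i * ⟦ f i ⟧ (y * x) + - w * (c i * v) ∎
        where
        u = ⟦ f i ⟧ y
        v = ⟦ f i ⟧ x
        w = f₀ y

    tail≈0 : ∀ i → c (suc i) ≈ 0#
    tail≈0 i with y , fy≉f₀y ← distinct (suc i) zero (λ ()) =
      cancel-nonzero
        (λ d≈0 → fy≉f₀y (trans (+-inverseˡ-unique _ _ d≈0) (-‿involutive _)))
        (automorphisms-independent (λ i → f (suc i))
          (λ i j i≢j → distinct (suc i) (suc j) (λ eq → i≢j (Finₚ.suc-injective eq)))
          (λ i → c (suc i) * (⟦ f (suc i) ⟧ y - f₀ y)) (relation′ y) i)

    c≈0 : ∀ i → c i ≈ 0#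
    c≈0 (suc i) = tail≈0 i
    c≈0 zero    = begin
      c zero                                   ≈⟨ *-identityʳ _ ⟨
      c zero * 1#                              ≈⟨ *-congˡ (1#-homo (f zero)) ⟨
      c zero * f₀ 1#                           ≈⟨ +-identityʳ _ ⟨
      c zero * f₀ 1# + 0#                      ≈⟨ +-congˡ (trans
        (sum-cong-≋ {k} (λ i → trans (*-congʳ (tail≈0 i)) (zeroˡ _))) (sum-replicate-zero k)) ⟨
      ∑[ i < suc k ] (c i * ⟦ f i ⟧ 1#)        ≈⟨ relation 1# ⟩
      0#                                       ∎

-- Automorphisms of an extension with a finite basis

module FiniteExtension {a ℓ} (K : Extension a ℓ) {N : ℕ}
  {e : Fin N → Extension.Carrier K} (basis : Extension.IsBasis K e) where

  open Extension K hiding (zero)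
  open ExtensionProperties K
  open IsBasis basis
  open Automorphism
  open Powers (Gal K)

  linear-zero : ∀ {q : Fin N → ℚ} → (∀ i → q i ≡ 0ℚ) → linear q e ≈ 0#
  linear-zero q≡0 = trans
    (sum-cong-≋ {N} (λ i → trans (*-congʳ (trans (reflexive (≡.cong ι (q≡0 i))) ι0)) (zeroˡ _)))
    (sum-replicate-zero N)
    where ι0 = RingMorphisms.IsRingHomomorphism.0#-homo ι-homo

  -- Coordinates in the basis reduce the question to rational numbers. Elimination and the finite
  -- searches below rest on this.
  ≈0? : ∀ x → Dec (x ≈ 0#)
  ≈0? x with q , x≈ ← spanning x =
    Dec.map′ (λ q≡0 → trans x≈ (linear-zero q≡0))
             (λ x≈0 → independent q (trans (sym x≈) x≈0))
             (all? (λ i → q i ℚₚ.≟ 0ℚ))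

  infix 4 _≈?_

  _≈?_ : ∀ x y → Dec (x ≈ y)
  x ≈? y = Dec.map′ (λ d≈0 → trans (+-inverseˡ-unique _ _ d≈0) (-‿involutive y))
                    (λ x≈y → trans (+-congʳ x≈y) (-‿inverseʳ y))
                    (≈0? (x - y))

  agree-on-basis : ∀ (σ τ : Automorphism K) → (∀ i → ⟦ σ ⟧ (e i) ≈ ⟦ τ ⟧ (e i)) → σ G.≈ τ
  agree-on-basis σ τ eq x with q , x≈ ← spanning x = begin
    ⟦ σ ⟧ x                       ≈⟨ ⟦⟧-cong σ x≈ ⟩
    ⟦ σ ⟧ (linear q e)            ≈⟨ linear-homo (automorphism⇒embedding σ) q e ⟩
    linear q (λ i → ⟦ σ ⟧ (e i))  ≈⟨ sum-cong-≋ {N} (λ i → *-congˡ (eq i)) ⟩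
    linear q (λ i → ⟦ τ ⟧ (e i))  ≈⟨ linear-homo (automorphism⇒embedding τ) q e ⟨
    ⟦ τ ⟧ (linear q e)            ≈⟨ ⟦⟧-cong τ x≈ ⟨
    ⟦ τ ⟧ x                       ∎
    where
    open Relation.Binary.Reasoning.Setoid setoid
    open EmbeddingProperties using (linear-homo)

  infix 4 _≈ᵍ?_

  _≈ᵍ?_ : ∀ (σ τ : Automorphism K) → Dec (σ G.≈ τ)
  σ ≈ᵍ? τ = Dec.map′ (agree-on-basis σ τ) (λ σ≈τ i → σ≈τ (e i))
                     (all? (λ i → ⟦ σ ⟧ (e i) ≈? ⟦ τ ⟧ (e i)))

  -- Different automorphisms differ on some basis element, found by search: the witness that
  -- `automorphisms-independent` asks for.
  distinguish : ∀ {σ τ : Automorphism K} → ¬ (σ G.≈ τ) → ∃ λ y → ¬ (⟦ σ ⟧ y ≈ ⟦ τ ⟧ y)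
  distinguish {σ} {τ} σ≉τ
    with i , neq ← ¬∀⟶∃¬ N _ (λ i → ⟦ σ ⟧ (e i) ≈? ⟦ τ ⟧ (e i))
                             (λ eq → σ≉τ (agree-on-basis σ τ eq)) = e i , neq

  -- Degree many equations, one for each basis element, cannot determine the
  -- coefficients of a relation between degree + 1 automorphisms.
  ¬-distinct : (f : Fin (suc N) → Automorphism K) → ¬ (∀ i j → i ≢ j → ¬ (f i G.≈ f j))
  ¬-distinct f distinct = c≉0 (automorphisms-independent f
    (λ i j i≢j → distinguish {f i} {f j} (distinct i j i≢j)) c relation i₀)
    where
    open Relation.Binary.Reasoning.Setoid setoid
    open Algebra.Properties.CommutativeSemigroup *-commutativeSemigroup using (x∙yz≈y∙xz)
    open LinearDependence commutativeRing ≈0? 1≉0 inverse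
    R = dependent (ℕₚ.n<1+n N) (λ i j → ⟦ f i ⟧ (e j))
    c = proj₁ R
    i₀ = proj₁ (proj₁ (proj₂ R))
    c≉0 = proj₂ (proj₁ (proj₂ R))

    relation : ∀ x → ∑[ i < suc N ] (c i * ⟦ f i ⟧ x) ≈ 0#
    relation x with q , x≈ ← spanning x = begin
      ∑[ i < suc N ] (c i * ⟦ f i ⟧ x)
        ≈⟨ sum-cong-≋ {suc N} (λ i → *-congˡ {c i} (trans (⟦⟧-cong (f i) x≈)
             (EmbeddingProperties.linear-homo (automorphism⇒embedding (f i)) q e))) ⟩
      ∑[ i < suc N ] (c i * ∑[ j < N ] (ι (q j) * ⟦ f i ⟧ (e j)))
        ≈⟨ sum-cong-≋ {suc N} (λ i → trans (*-distribˡ-sum {N} (c i) _) (sum-cong-≋ {N} (λ j →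
             x∙yz≈y∙xz (c i) (ι (q j)) (⟦ f i ⟧ (e j))))) ⟩
      ∑[ i < suc N ] ∑[ j < N ] (ι (q j) * (c i * ⟦ f i ⟧ (e j)))
        ≈⟨ ∑-comm {suc N} {N} (λ i j → ι (q j) * (c i * ⟦ f i ⟧ (e j))) ⟩
      ∑[ j < N ] ∑[ i < suc N ] (ι (q j) * (c i * ⟦ f i ⟧ (e j)))
        ≈⟨ sum-cong-≋ {N} (λ j → trans
          (sym (*-distribˡ-sum {suc N} (ι (q j)) (λ i → c i * ⟦ f i ⟧ (e j))))
             (trans (*-congˡ (proj₂ (proj₂ R) j)) (zeroʳ _))) ⟩
      ∑[ j < N ] 0# ≈⟨ sum-replicate-zero N ⟩
      0# ∎

  -- By `¬-distinct` the powers γ⁰, ..., γᴺ are not pairwise distinct, so a search over pairs of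
  -- exponents succeeds; the difference of the two is a period of γ, perhaps a proper multiple of
  -- its order.
  order : ∀ γ → ∃ λ d → 0 ℕ.< d × d ℕ.≤ N × γ ↑ d G.≈ G.ε
  order γ with any? (λ (i : Fin (suc N)) → any? (λ (j : Fin (suc N)) →
                 toℕ i ℕₚ.<? toℕ j ×-dec γ ↑ toℕ i ≈ᵍ? γ ↑ toℕ j))
  ... | no none = contradiction distinct (¬-distinct (λ i → γ ↑ toℕ i))
    where
    distinct : ∀ (i j : Fin (suc N)) → i ≢ j → ¬ (γ ↑ toℕ i G.≈ γ ↑ toℕ j)
    distinct i j i≢j eq with ℕₚ.<-cmp (toℕ i) (toℕ j)
    ... | tri< i<j _ _ = none (i , j , i<j , eq)
    ... | tri≈ _ i≡j _ = i≢j (Finₚ.toℕ-injective i≡j)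
    ... | tri> _ _ j<i = none (j , i , j<i , G.sym {γ ↑ toℕ i} {γ ↑ toℕ j} eq)
  ... | yes (i , j , i<j , eq) =
    toℕ j ℕ.∸ toℕ i , ℕₚ.m<n⇒0<n∸m i<j ,
    ℕₚ.≤-trans (ℕₚ.m∸n≤m (toℕ j) (toℕ i)) (s≤s⁻¹ (Finₚ.toℕ<n j)) ,
    ↑-∸ (ℕₚ.<⇒≤ i<j) eq
    where open PowerProperties (Gal K)

  -- The exponents supplied by `IsGenerator` are reduced modulo a period at most N. `ix` need not
  -- respect equality of automorphisms; recovering `x` from `ix x` makes it injective, which bounds
  -- the group by N elements.
  index : ∀ γ → IsGenerator γ → ∃ λ (ix : Automorphism K → Fin N) → ∀ x → x G.≈ γ ↑ toℕ (ix x)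
  index γ gen with d@(suc _) , _ , d≤N , γ^d≈ε ← order γ = ix , in-range
    where
    open PowerProperties (Gal K)
    below : ∀ x → proj₁ (gen x) % d ℕ.< N
    below x = ℕₚ.<-≤-trans (ℕ/.m%n<n (proj₁ (gen x)) d) d≤N
    ix : Automorphism K → Fin N
    ix x = fromℕ< (below x)
    in-range : ∀ x → x G.≈ γ ↑ toℕ (ix x)
    in-range x = ≡.subst (λ k → x G.≈ γ ↑ k) (≡.sym (Finₚ.toℕ-fromℕ< (below x)))
      (λ z → trans (proj₂ (gen x) z) (↑-% d γ^d≈ε (proj₁ (gen x)) z))

-- Geometric sums and rational spans

module Geometric {a ℓ} (L : Extension a ℓ) where
  open Extension L hiding (zero)
  open ExtensionProperties L
  open Relation.Binary.Reasoning.Setoid setoid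

  geometric : ℕ → Carrier → Carrier
  geometric k x = ∑[ i < k ] (x ^ toℕ i)

  geometric-step : ∀ k x → geometric (suc k) x ≈ 1# + x * geometric k x
  geometric-step k x = +-congˡ (sym (*-distribˡ-sum {k} x (λ i → x ^ toℕ i)))

  geometric-last : ∀ k x → geometric (suc k) x ≈ geometric k x + x ^ k
  geometric-last zero    x = +-comm _ _
  geometric-last (suc k) x = begin
    geometric (suc (suc k)) x              ≈⟨ geometric-step (suc k) x ⟩
    1# + x * geometric (suc k) x           ≈⟨ +-congˡ (*-congˡ (geometric-last k x)) ⟩
    1# + x * (geometric k x + x ^ k)       ≈⟨ +-congˡ (distribˡ _ _ _) ⟩
    1# + (x * geometric k x + x ^ suc k)   ≈⟨ +-assoc _ _ _ ⟨
    1# + x * geometric k x + x ^ suc k     ≈⟨ +-congʳ (geometric-step k x) ⟨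
    geometric (suc k) x + x ^ suc k        ∎

  -- Splitting off the first or the last term of `geometric (suc k) x` gives 1 + x g = g + xᵏ = g +
  -- 1, so (x - 1) g = 0 with x - 1 nonzero.
  geometric-root-of-unity : ∀ k x → ¬ (x ≈ 1#) → x ^ k ≈ 1# → geometric k x ≈ 0#
  geometric-root-of-unity k x x≉1 x^k≈1 = cancel-nonzero x-1≉0 (begin
    g * (x - 1#)         ≈⟨ distribˡ _ _ _ ⟩
    g * x + g * - 1#
      ≈⟨ +-cong (*-comm g x) (trans (sym (-‿distribʳ-* g 1#)) (-‿cong (*-identityʳ g))) ⟩
    x * g - g            ≈⟨ +-congʳ xg≈g ⟩
    g - g                ≈⟨ -‿inverseʳ g ⟩
    0#                   ∎)
    where
    g = geometric k x
    x-1≉0 : ¬ (x - 1# ≈ 0#)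
    x-1≉0 eq = x≉1 (trans (+-inverseˡ-unique _ _ eq) (-‿involutive 1#))
    xg≈g : x * g ≈ g
    xg≈g = +-cancelˡ 1# _ _ (begin
      1# + x * g         ≈⟨ geometric-step k x ⟨
      geometric (suc k) x ≈⟨ geometric-last k x ⟩
      g + x ^ k          ≈⟨ +-congˡ x^k≈1 ⟩
      g + 1#             ≈⟨ +-comm g 1# ⟩
      1# + g             ∎)

module Spans {a ℓ} (L : Extension a ℓ) {m : ℕ} (w : Fin m → Extension.Carrier L) where
  open Extension L hiding (zero)
  open ExtensionProperties L
  open RingMorphisms.IsRingHomomorphism ι-homo using () renaming
    (+-homo to ι-+; *-homo to ι-*; 0#-homo to ι-0; 1#-homo to ι-1)
  open Relation.Binary.Reasoning.Setoid setoid

  Span : Carrier → Set _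
  Span x = ∃ λ q → x ≈ linear q w

  span-cong : ∀ {x y} → x ≈ y → Span y → Span x
  span-cong x≈y (q , y≈) = q , trans x≈y y≈

  span-+ : ∀ {x y} → Span x → Span y → Span (x + y)
  span-+ {x} {y} (q , x≈) (r , y≈) = (λ i → q i ℚ.+ r i) , (begin
    x + y                  ≈⟨ +-cong x≈ y≈ ⟩
    linear q w + linear r w ≈⟨ ∑-distrib-+ {m} (λ i → ι (q i) * w i) (λ i → ι (r i) * w i) ⟨
    ∑[ i < m ] (ι (q i) * w i + ι (r i) * w i)
      ≈⟨ sum-cong-≋ {m} (λ i → trans (*-congʳ (ι-+ (q i) (r i))) (distribʳ _ _ _)) ⟨
    linear (λ i → q i ℚ.+ r i) w ∎)

  span-scale : ∀ s {x} → Span x → Span (ι s * x)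
  span-scale s {x} (q , x≈) = (λ i → s ℚ.* q i) , (begin
    ι s * x           ≈⟨ *-congˡ x≈ ⟩
    ι s * linear q w  ≈⟨ *-distribˡ-sum {m} (ι s) (λ i → ι (q i) * w i) ⟩
    ∑[ i < m ] (ι s * (ι (q i) * w i))
      ≈⟨ sum-cong-≋ {m} (λ i → trans (*-congʳ (ι-* s (q i))) (*-assoc _ _ _)) ⟨
    linear (λ i → s ℚ.* q i) w ∎)

  span-0 : Span 0#
  span-0 = (λ _ → 0ℚ) , sym (trans
    (sum-cong-≋ {m} (λ i → trans (*-congʳ ι-0) (zeroˡ (w i)))) (sum-replicate-zero m))

  span-neg : ∀ {x} → Span x → Span (- x)
  span-neg {x} s = span-cong (begin
    - x              ≈⟨ -1*x≈-x x ⟨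
    - 1# * x         ≈⟨ *-congʳ (-‿cong ι-1) ⟨
    - ι 1ℚ * x       ≈⟨ *-congʳ (RingMorphisms.IsRingHomomorphism.-‿homo ι-homo 1ℚ) ⟨
    ι (ℚ.- 1ℚ) * x   ∎) (span-scale (ℚ.- 1ℚ) s)

  span-sum : ∀ {k} {x : Fin k → Carrier} → (∀ i → Span (x i)) → Span (∑[ i < k ] x i)
  span-sum {zero}  s = span-0
  span-sum {suc k} s = span-+ (s zero) (span-sum {k} (λ i → s (suc i)))

  span-generator : ∀ i → Span (w i)
  span-generator i = (λ j → δ i j) , sym (go w i)
    where
    δ : ∀ {k} → Fin k → Fin k → ℚ
    δ zero    zero    = 1ℚ
    δ zero    (suc j) = 0ℚ
    δ (suc i) zero    = 0ℚ
    δ (suc i) (suc j) = δ i j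
    go : ∀ {k} (w : Fin k → Carrier) i → linear (δ i) w ≈ w i
    go {suc k} w zero = trans (+-cong (trans (*-congʳ ι-1) (*-identityˡ _))
      (trans (sum-cong-≋ {k} (λ j → trans (*-congʳ ι-0) (zeroˡ (w (suc j)))))
        (sum-replicate-zero k)))
      (+-identityʳ _)
    go {suc k} w (suc i) = trans (+-cong (trans (*-congʳ ι-0) (zeroˡ _)) (go (λ j → w (suc j)) i))
      (+-identityˡ _)

-- The cyclotomic field and its subfield of p-power degree

module Cyclotomic {a ℓ} {p : ℕ} (prime : Prime p) (n : ℕ) (L : Extension a ℓ)
  {ζ : Extension.Carrier L} (cyclotomic : IsCyclotomic (p ℕ.^ suc (suc n)) L ζ) where
  open Extension L hiding (zero)
  open ExtensionProperties L
  open Algebra.Properties.Semiring.Exp semiring using (^-congˡ; ^-congʳ; ^-homo-*; ^-assocʳ)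
  open Algebra.Properties.CommutativeSemiring.Exp commutativeSemiring using (^-distrib-*)
  open Geometric L
  open IsCyclotomic cyclotomic
  open Automorphism
  open Powers (Gal L)
  open Relation.Binary.Reasoning.Setoid setoid

  -- `n` is one below the level of the layer, so ζ has order p^(n+2) and K has degree p^(n+1). `m`
  -- is Euler's function at p^(n+1), the order of ζᵖ.
  M m : ℕ
  M = p ℕ.^ suc (suc n)
  m = p ℕ.^ n ℕ.* ℕ.pred p

  private instance
    p≢0 : NonZero p
    p≢0 = prime⇒nonZero prime
    M≢0 : NonZero M
    M≢0 = ℕₚ.m^n≢0 p (suc (suc n))

  1^ : ∀ k → 1# ^ k ≈ 1#
  1^ zero    = refl
  1^ (suc k) = trans (*-identityˡ _) (1^ k)

  ^-multiple : ∀ {x} i {k} → x ^ i ≈ 1# → i ℕ∣.∣ k → x ^ k ≈ 1#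
  ^-multiple {x} i x^i≈1 (ℕ∣.divides q ≡.refl) = trans (^-congʳ x (ℕₚ.*-comm q i))
    (trans (sym (^-assocʳ x i q)) (trans (^-congˡ q x^i≈1) (1^ q)))

  ζ^-periodic : ∀ i z → ζ ^ (i ℕ.+ M ℕ.* z) ≈ ζ ^ i
  ζ^-periodic i z = trans (^-homo-* ζ i (M ℕ.* z))
    (trans (*-congˡ (^-multiple M root (ℕ∣.m∣m*n z))) (*-identityʳ _))

  ζ^≉1 : ∀ {k} → ¬ (M ℕ∣.∣ k) → ¬ (ζ ^ k ≈ 1#)
  ζ^≉1 {k} M∤k ζ^k≈1 with k % M in k%M≡
  ... | zero  = M∤k (ℕ∣.m%n≡0⇒n∣m k M k%M≡)
  ... | suc r = exactOrder (suc r) (ℕ.s≤s ℕ.z≤n) (≡.subst (ℕ._< M) k%M≡ (ℕ/.m%n<n k M)) (begin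
    ζ ^ suc r                          ≈⟨ ζ^-periodic (suc r) (k ℕ/./ M) ⟨
    ζ ^ (suc r ℕ.+ M ℕ.* (k ℕ/./ M))
      ≈⟨ ^-congʳ ζ (≡.trans (≡.cong₂ ℕ._+_ k%M≡ (ℕₚ.*-comm (k ℕ/./ M) M)) ≡.refl) ⟨
    ζ ^ (k % M ℕ.+ k ℕ/./ M ℕ.* M)     ≈⟨ ^-congʳ ζ (ℕ/.m≡m%n+[m/n]*n k M) ⟨
    ζ ^ k                              ≈⟨ ζ^k≈1 ⟩
    1#                                 ∎)

  ζ^[p^n*u]≉1 : ∀ u → ¬ (p ℕ∣.∣ u) → ¬ (ζ ^ (p ℕ.^ suc n ℕ.* u) ≈ 1#)
  ζ^[p^n*u]≉1 u p∤u = ζ^≉1 (∤⇒^suc∤ prime (suc n) u p∤u)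

  ζ^[p^n*u]^p≈1 : ∀ u → (ζ ^ (p ℕ.^ suc n ℕ.* u)) ^ p ≈ 1#
  ζ^[p^n*u]^p≈1 u = trans (^-assocʳ ζ (p ℕ.^ suc n ℕ.* u) p)
    (^-multiple M root (ℕ∣.divides u (reorder p (p ℕ.^ suc n) u)))
    where
    reorder : ∀ p q u → q ℕ.* u ℕ.* p ≡ u ℕ.* (p ℕ.* q)
    reorder = ℕ-Solver.solve-∀

  open Spans L {m} (λ s → ζ ^ (p ℕ.* toℕ s))

  private
    ω : Carrier
    ω = ζ ^ (p ℕ.^ suc n)

  ω^[p-1] : ω ^ ℕ.pred p ≈ - geometric (ℕ.pred p) ω
  ω^[p-1] = +-inverseʳ-unique _ _ (begin
    geometric (ℕ.pred p) ω + ω ^ ℕ.pred p  ≈⟨ geometric-last (ℕ.pred p) ω ⟨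
    geometric (suc (ℕ.pred p)) ω           ≡⟨ ≡.cong (λ k → geometric k ω) (ℕₚ.suc-pred p) ⟩
    geometric p ω                          ≈⟨ geometric-root-of-unity p ω ω≉1 ω^p≈1 ⟩
    0#                                     ∎)
    where
    ω≈ : ω ≈ ζ ^ (p ℕ.^ suc n ℕ.* 1)
    ω≈ = ^-congʳ ζ (≡.sym (ℕₚ.*-identityʳ (p ℕ.^ suc n)))
    ω≉1 : ¬ (ω ≈ 1#)
    ω≉1 ω≈1 = ζ^[p^n*u]≉1 1 (p∤1 prime) (trans (sym ω≈) ω≈1)
    ω^p≈1 : ω ^ p ≈ 1#
    ω^p≈1 = trans (^-congˡ p ω≈) (ζ^[p^n*u]^p≈1 1)

  -- For s ≥ m a factor ω^(p-1) splits off, and 1 + ω + ... + ω^(p-1) = 0 replaces it by lower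
  -- powers of ω. The new exponents are p (r + pⁿ i) with i < p - 1, and r + pⁿ i < r + m = s allows
  -- the strong induction.
  span-ζ^[p*s] : ∀ s → Span (ζ ^ (p ℕ.* s))
  span-ζ^[p*s] = <-rec _ λ s IH → case s IH (s ℕₚ.<? m)
    where
    case : ∀ s → (∀ {t} → t ℕ.< s → Span (ζ ^ (p ℕ.* t))) → Dec (s ℕ.< m) → Span (ζ ^ (p ℕ.* s))
    case s IH (yes s<m) = ≡.subst (λ k → Span (ζ ^ (p ℕ.* k))) (Finₚ.toℕ-fromℕ< s<m)
      (span-generator (fromℕ< s<m))
    case s IH (no s≮m) = span-cong (begin
      ζ ^ (p ℕ.* s)
        ≡⟨ ≡.cong (ζ ^_) (≡.trans (≡.cong (p ℕ.*_) (≡.sym s≡r+m))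
          (regroup p r (p ℕ.^ n) (ℕ.pred p))) ⟩
      ζ ^ (p ℕ.* r ℕ.+ p ℕ.^ suc n ℕ.* ℕ.pred p)
        ≈⟨ trans (^-homo-* ζ (p ℕ.* r) _) (*-congˡ (sym (^-assocʳ ζ (p ℕ.^ suc n) (ℕ.pred p)))) ⟩
      ζ ^ (p ℕ.* r) * ω ^ ℕ.pred p
        ≈⟨ *-congˡ ω^[p-1] ⟩
      ζ ^ (p ℕ.* r) * - geometric (ℕ.pred p) ω
        ≈⟨ -‿distribʳ-* _ _ ⟨
      - (ζ ^ (p ℕ.* r) * geometric (ℕ.pred p) ω)
        ≈⟨ -‿cong (*-distribˡ-sum {ℕ.pred p} _ (λ i → ω ^ toℕ i)) ⟩
      - ∑[ i < ℕ.pred p ] (ζ ^ (p ℕ.* r) * ω ^ toℕ i) ∎)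
      (span-neg (span-sum {ℕ.pred p} λ i → span-cong
        (trans (*-congˡ (^-assocʳ ζ (p ℕ.^ suc n) (toℕ i)))
          (trans (sym (^-homo-* ζ (p ℕ.* r) _))
                 (^-congʳ ζ (≡.sym (regroup p r (p ℕ.^ n) (toℕ i))))))
        (IH (≡.subst (r ℕ.+ p ℕ.^ n ℕ.* toℕ i ℕ.<_) s≡r+m
          (ℕₚ.+-monoʳ-< r (ℕₚ.*-monoʳ-< (p ℕ.^ n) {{ℕₚ.m^n≢0 p n}} (Finₚ.toℕ<n i)))))))
      where
      r = s ℕ.∸ m
      s≡r+m : r ℕ.+ m ≡ s
      s≡r+m = ℕₚ.m∸n+n≡m (ℕₚ.≮⇒≥ s≮m)
      regroup : ∀ p r q k → p ℕ.* (r ℕ.+ q ℕ.* k) ≡ p ℕ.* r ℕ.+ p ℕ.* q ℕ.* k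
      regroup = ℕ-Solver.solve-∀

  ^-homo : ∀ (τ : Automorphism L) x k → ⟦ τ ⟧ (x ^ k) ≈ ⟦ τ ⟧ x ^ k
  ^-homo τ x zero    = 1#-homo τ
  ^-homo τ x (suc k) = trans (*-homo τ x (x ^ k)) (*-congˡ (^-homo τ x k))

  ↑-fixes : ∀ {τ : Automorphism L} {x} → ⟦ τ ⟧ x ≈ x → ∀ k → ⟦ τ ↑ k ⟧ x ≈ x
  ↑-fixes {τ} τx≈x zero    = refl
  ↑-fixes {τ} τx≈x (suc k) = trans (⟦⟧-cong τ (↑-fixes {τ} τx≈x k)) τx≈x

  ↑-ζ : ∀ {τ : Automorphism L} {c} → ⟦ τ ⟧ ζ ≈ ζ ^ c → ∀ k → ⟦ τ ↑ k ⟧ ζ ≈ ζ ^ (c ℕ.^ k)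
  ↑-ζ {τ} {c} τζ≈ zero    = sym (*-identityʳ ζ)
  ↑-ζ {τ} {c} τζ≈ (suc k) = begin
    ⟦ τ ⟧ (⟦ τ ↑ k ⟧ ζ)   ≈⟨ ⟦⟧-cong τ (↑-ζ {τ} τζ≈ k) ⟩
    ⟦ τ ⟧ (ζ ^ (c ℕ.^ k)) ≈⟨ ^-homo τ ζ (c ℕ.^ k) ⟩
    ⟦ τ ⟧ ζ ^ (c ℕ.^ k)   ≈⟨ ^-congˡ (c ℕ.^ k) τζ≈ ⟩
    (ζ ^ c) ^ (c ℕ.^ k)   ≈⟨ ^-assocʳ ζ c (c ℕ.^ k) ⟩
    ζ ^ (c ℕ.^ suc k)     ∎

  -- An automorphism τ of order p: ζ ↦ ζ ω′ with ω′ of order p.  The sum of its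
  -- iterates kills ζ ^ i unless p ∣ i, so it maps into the span of the powers
  -- of ζ ^ p.
  module Trace {τ : Automorphism L} {u : ℕ} (p∤u : ¬ (p ℕ∣.∣ u))
               (τζ≈ : ⟦ τ ⟧ ζ ≈ ζ ^ (1 ℕ.+ p ℕ.^ suc n ℕ.* u)) where

    private
      e : ℕ
      e = p ℕ.^ suc n ℕ.* u
      ω′ : Carrier
      ω′ = ζ ^ e

    -- p divides e and ω′ᵖ = 1, so τ multiplies ω′ by ω′ᵉ = 1. Iterating τ on ζ therefore just
    -- accumulates factors ω′.
    τω′≈ω′ : ⟦ τ ⟧ ω′ ≈ ω′
    τω′≈ω′ = begin
      ⟦ τ ⟧ (ζ ^ e)   ≈⟨ ^-homo τ ζ e ⟩
      ⟦ τ ⟧ ζ ^ e     ≈⟨ ^-congˡ e τζ≈ ⟩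
      (ζ * ω′) ^ e    ≈⟨ ^-distrib-* ζ ω′ e ⟩
      ω′ * ω′ ^ e
        ≈⟨ *-congˡ (^-multiple p (ζ^[p^n*u]^p≈1 u) (ℕ∣.∣m⇒∣m*n u (ℕ∣.m∣m*n (p ℕ.^ n)))) ⟩
      ω′ * 1#         ≈⟨ *-identityʳ ω′ ⟩
      ω′              ∎

    τ↑ζ : ∀ k → ⟦ τ ↑ k ⟧ ζ ≈ ζ * ω′ ^ k
    τ↑ζ zero    = sym (*-identityʳ ζ)
    τ↑ζ (suc k) = begin
      ⟦ τ ⟧ (⟦ τ ↑ k ⟧ ζ)        ≈⟨ ⟦⟧-cong τ (τ↑ζ k) ⟩
      ⟦ τ ⟧ (ζ * ω′ ^ k)         ≈⟨ *-homo τ ζ (ω′ ^ k) ⟩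
      ⟦ τ ⟧ ζ * ⟦ τ ⟧ (ω′ ^ k)   ≈⟨ *-cong τζ≈ (trans (^-homo τ ω′ k) (^-congˡ k τω′≈ω′)) ⟩
      ζ * ω′ * ω′ ^ k            ≈⟨ *-assoc _ _ _ ⟩
      ζ * ω′ ^ suc k             ∎

    τ↑ζ^ : ∀ k i → ⟦ τ ↑ k ⟧ (ζ ^ i) ≈ ζ ^ i * (ω′ ^ i) ^ k
    τ↑ζ^ k i = begin
      ⟦ τ ↑ k ⟧ (ζ ^ i)       ≈⟨ ^-homo (τ ↑ k) ζ i ⟩
      ⟦ τ ↑ k ⟧ ζ ^ i         ≈⟨ ^-congˡ i (τ↑ζ k) ⟩
      (ζ * ω′ ^ k) ^ i        ≈⟨ ^-distrib-* ζ (ω′ ^ k) i ⟩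
      ζ ^ i * (ω′ ^ k) ^ i    ≈⟨ *-congˡ (trans (^-assocʳ ω′ k i)
                                   (trans (^-congʳ ω′ (ℕₚ.*-comm k i)) (sym (^-assocʳ ω′ i k)))) ⟩
      ζ ^ i * (ω′ ^ i) ^ k    ∎

    trace : Carrier → Carrier
    trace x = ∑[ k < p ] ⟦ τ ↑ toℕ k ⟧ x

    span-trace-ζ^ : ∀ i → Span (trace (ζ ^ i))
    span-trace-ζ^ i with p ℕ∣.∣? i
    ... | yes p∣i@(ℕ∣.divides s ≡.refl) = span-sum {p} λ k → span-cong
      (begin
        ⟦ τ ↑ toℕ k ⟧ (ζ ^ i)      ≈⟨ τ↑ζ^ (toℕ k) i ⟩
        ζ ^ i * (ω′ ^ i) ^ toℕ k
          ≈⟨ *-congˡ (trans (^-congˡ (toℕ k) (^-multiple p (ζ^[p^n*u]^p≈1 u) p∣i)) (1^ (toℕ k))) ⟩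
        ζ ^ i * 1#                 ≈⟨ *-identityʳ _ ⟩
        ζ ^ i                      ≡⟨ ≡.cong (ζ ^_) (ℕₚ.*-comm s p) ⟩
        ζ ^ (p ℕ.* s)              ∎)
      (span-ζ^[p*s] s)
    ... | no p∤i = span-cong
      (begin
        trace (ζ ^ i)                  ≈⟨ sum-cong-≋ {p} (λ k → τ↑ζ^ (toℕ k) i) ⟩
        ∑[ k < p ] (ζ ^ i * (ω′ ^ i) ^ toℕ k)
                                       ≈⟨ *-distribˡ-sum {p} (ζ ^ i) (λ k → (ω′ ^ i) ^ toℕ k) ⟨
        ζ ^ i * geometric p (ω′ ^ i)   ≈⟨ *-congˡ (geometric-root-of-unity p (ω′ ^ i) ω′^i≉1
                                            (trans (^-assocʳ ω′ i p)
                                              (^-multiple p (ζ^[p^n*u]^p≈1 u) (ℕ∣.n∣m*n i)))) ⟩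
        ζ ^ i * 0#                     ≈⟨ zeroʳ _ ⟩
        0#                             ∎)
      span-0
      where
      ω′^i≉1 : ¬ (ω′ ^ i ≈ 1#)
      ω′^i≉1 eq = ζ^[p^n*u]≉1 (u ℕ.* i)
        (λ d → [ p∤u , p∤i ]′ (euclidsLemma u i prime d))
        (trans (^-congʳ ζ (≡.sym (ℕₚ.*-assoc (p ℕ.^ suc n) u i))) (trans (sym (^-assocʳ ζ e i)) eq))

    span-trace : ∀ x → Span (trace x)
    span-trace x with k , q , x≈ ← generates x = span-cong
      (begin
        trace x ≈⟨ sum-cong-≋ {p} (λ j → trans (⟦⟧-cong (τ ↑ toℕ j) x≈)
                     (EmbeddingProperties.linear-homo (automorphism⇒embedding (τ ↑ toℕ j)) q
                       (λ i → ζ ^ toℕ i))) ⟩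
        ∑[ j < p ] ∑[ i < k ] (ι (q i) * ⟦ τ ↑ toℕ j ⟧ (ζ ^ toℕ i))
          ≈⟨ ∑-comm {p} {k} (λ j i → ι (q i) * ⟦ τ ↑ toℕ j ⟧ (ζ ^ toℕ i)) ⟩
        ∑[ i < k ] ∑[ j < p ] (ι (q i) * ⟦ τ ↑ toℕ j ⟧ (ζ ^ toℕ i))
          ≈⟨ sum-cong-≋ {k} (λ i → *-distribˡ-sum {p} (ι (q i)) (λ j → ⟦ τ ↑ toℕ j ⟧ (ζ ^ toℕ i))) ⟨
        ∑[ i < k ] (ι (q i) * trace (ζ ^ toℕ i)) ∎)
      (span-sum {k} λ i → span-scale (q i) (span-trace-ζ^ (toℕ i)))

    -- On fixed elements the trace is multiplication by p, which ℚ inverts.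
    span-fixed : ∀ {x} → ⟦ τ ⟧ x ≈ x → Span x
    span-fixed {x} τx≈x = span-cong
      (begin
        x                                      ≈⟨ *-identityˡ x ⟨
        1# * x                                 ≈⟨ *-congʳ ι-1 ⟨
        ι 1ℚ * x                               ≡⟨ ≡.cong (λ r → ι r * x) (ℚₚ.*-inverseˡ pℚ) ⟨
        ι (ℚ.1/ pℚ ℚ.* pℚ) * x
          ≈⟨ trans (*-congʳ (ι-* (ℚ.1/ pℚ) pℚ)) (*-assoc _ _ _) ⟩
        ι (ℚ.1/ pℚ) * (ι pℚ * x)
          ≈⟨ *-congˡ (trans (*-congʳ (ι-multiple p)) (trans (*-distribʳ-sum {p} x (λ _ → 1#))
                                                    (sum-cong-≋ {p} (λ _ → *-identityˡ x)))) ⟩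
        ι (ℚ.1/ pℚ) * ∑[ k < p ] x
          ≈⟨ *-congˡ (sum-cong-≋ {p} (λ k → ↑-fixes {τ} τx≈x (toℕ k))) ⟨
        ι (ℚ.1/ pℚ) * trace x                  ∎)
      (span-scale (ℚ.1/ pℚ) (span-trace x))
      where
      open RingMorphisms.IsRingHomomorphism ι-homo using () renaming
        (+-homo to ι-+; *-homo to ι-*; 0#-homo to ι-0; 1#-homo to ι-1)
      -- p as a sum of ones, which `ι` carries term by term into L; nonnegativity of the partial
      -- sums makes it nonzero.
      multiple : ℕ → ℚ
      multiple zero    = 0ℚ
      multiple (suc k) = 1ℚ ℚ.+ multiple k
      multiple-nonNeg : ∀ k → ℚ.NonNegative (multiple k)
      multiple-nonNeg zero    = _
      multiple-nonNeg (suc k) = ℚₚ.nonNeg+nonNeg⇒nonNeg 1ℚ (multiple k) {{multiple-nonNeg k}}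
      multiple≢0 : ∀ k .{{_ : NonZero k}} → ℚ.NonZero (multiple k)
      multiple≢0 (suc k) = ℚₚ.pos⇒nonZero (1ℚ ℚ.+ multiple k)
        {{ℚₚ.pos+nonNeg⇒pos 1ℚ (multiple k) {{multiple-nonNeg k}}}}
      ι-multiple : ∀ k → ι (multiple k) ≈ ∑[ i < k ] 1#
      ι-multiple zero    = ι-0
      ι-multiple (suc k) = trans (ι-+ 1ℚ (multiple k)) (+-cong ι-1 (ι-multiple k))
      pℚ = multiple p
      instance
        pℚ≢0 : ℚ.NonZero pℚ
        pℚ≢0 = multiple≢0 p

  m<degree : m ℕ.< p ℕ.^ suc n
  m<degree = ≡.subst (m ℕ.<_) (ℕₚ.*-comm (p ℕ.^ n) p)
    (ℕₚ.*-monoʳ-< (p ℕ.^ n) {{ℕₚ.m^n≢0 p n}} (ℕₚ.≤-reflexive (ℕₚ.suc-pred p)))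

  module Subfield {a′ ℓ′} {K : Extension a′ ℓ′} (E : Embedding K L)
                  (degree : Extension.HasDegree K (p ℕ.^ suc n)) where
    private
      module K = Extension K
    open Embedding E using () renaming (⟦_⟧ to incl)

    -- K has p^(n+1) basis elements and the spanning family only m. Elimination over ℚ on the
    -- coordinate rows `A i` gives a nontrivial relation, which the embedding reflects back to K,
    -- against independence.
    not-in-span : ¬ (∀ y → Span (incl y))
    not-in-span incl∈ = reflects-0 (begin
      incl (K.linear c e)                      ≈⟨ linear-homo c e ⟩
      ∑[ i < N ] (ι (c i) * incl (e i))
        ≈⟨ sum-cong-≋ {N} (λ i → *-congˡ (proj₂ (incl∈ (e i)))) ⟩
      ∑[ i < N ] (ι (c i) * linear (A i) w)    ≈⟨ sum-cong-≋ {N} (λ i → trans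
        (*-distribˡ-sum {m} (ι (c i)) (λ s → ι (A i s) * w s))
        (sum-cong-≋ {m} (λ s → trans (sym (*-assoc _ _ _)) (*-congʳ (sym (ι-* (c i) (A i s))))))) ⟩
      ∑[ i < N ] ∑[ s < m ] (ι (c i ℚ.* A i s) * w s)
        ≈⟨ ∑-comm {N} {m} (λ i s → ι (c i ℚ.* A i s) * w s) ⟩
      ∑[ s < m ] ∑[ i < N ] (ι (c i ℚ.* A i s) * w s)
        ≈⟨ sum-cong-≋ {m} (λ s → trans (sym (*-distribʳ-sum {N} (w s) (λ i → ι (c i ℚ.* A i s))))
             (trans (*-congʳ (trans (sym (ι-sum (λ i → c i ℚ.* A i s)))
               (trans (reflexive (≡.cong ι (relation s))) ι-0))) (zeroˡ _))) ⟩
      ∑[ s < m ] 0# ≈⟨ sum-replicate-zero m ⟩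
      0# ∎)
      (λ comb≈0 → c≢0 (K.IsBasis.independent basis c comb≈0 i₀))
      where
      open EmbeddingProperties E using (linear-homo; reflects-0)
      open RingMorphisms.IsRingHomomorphism ι-homo using () renaming
        (+-homo to ι-+; *-homo to ι-*; 0#-homo to ι-0; 1#-homo to ι-1)
      module ℚΣ = Algebra.Properties.Semiring.Sum (CommutativeRing.semiring ℚₚ.+-*-commutativeRing)
      N = p ℕ.^ suc n
      e = proj₁ degree
      basis = proj₂ degree
      w : Fin m → Carrier
      w s = ζ ^ (p ℕ.* toℕ s)
      A : Fin N → Fin m → ℚ
      A i = proj₁ (incl∈ (e i))
      open LinearDependence ℚₚ.+-*-commutativeRing (ℚₚ._≟ 0ℚ) (λ ())
        (λ q q≢0 → ℚ.1/_ q {{ℚ.≢-nonZero q≢0}} , ℚₚ.*-inverseʳ q {{ℚ.≢-nonZero q≢0}})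
      R = dependent m<degree A
      c = proj₁ R
      i₀ = proj₁ (proj₁ (proj₂ R))
      c≢0 = proj₂ (proj₁ (proj₂ R))
      relation = proj₂ (proj₂ R)
      ι-sum : ∀ {k} (v : Fin k → ℚ) → ι (ℚΣ.sum v) ≈ ∑[ i < k ] ι (v i)
      ι-sum {zero}  v = ι-0
      ι-sum {suc k} v = trans (ι-+ _ _) (+-congˡ (ι-sum (λ i → v (suc i))))

    no-fixing-automorphism : ∀ {τ : Automorphism L} {y} → ¬ (2 ℕ∣.∣ p) → ¬ (p ℕ.^ suc n ℕ∣.∣ y) →
      ⟦ τ ⟧ ζ ≈ ζ ^ (1 ℕ.+ p ℕ.* y) → ¬ (∀ x → ⟦ τ ⟧ (incl x) ≈ incl x)
    no-fixing-automorphism {τ} {y} 2∤p p^n∤y τζ≈ fixes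
      with k , u , eq , p∤u ← power-of-1-unit prime 2∤p (suc n) y p^n∤y =
      not-in-span (λ x → span-fixed (↑-fixes {τ} (fixes x) k))
      where open Trace {τ ↑ k} p∤u (trans (↑-ζ {τ} τζ≈ k) (reflexive (≡.cong (ζ ^_) eq)))

    -- The quotient τ = σ′⁻¹ σ fixes K if the two agree there. Its value at ζ is compared after
    -- applying the injective σ′, so that σ′⁻¹ never has to be evaluated.
    separates : ∀ {σ σ′ : Automorphism L} {c s} → ¬ (2 ℕ∣.∣ p) → Coprime c (p ℕ.^ suc (suc n)) →
      0 ℕ.< s → s ℕ.< p ℕ.^ suc n →
      ⟦ σ ⟧ ζ ≈ ζ ^ (c ℕ.+ p ℕ.* s) → ⟦ σ′ ⟧ ζ ≈ ζ ^ c →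
      ¬ (∀ x → ⟦ σ ⟧ (incl x) ≈ ⟦ σ′ ⟧ (incl x))
    separates {σ} {σ′} {c} {s} 2∤p cop 0<s s<p^n σζ≈ σ′ζ≈ agree
      with y , z , p^n∤y , eq ← quotient-unit prime (suc n) {s = s} cop ≡.refl 0<s s<p^n =
      no-fixing-automorphism {τ} 2∤p p^n∤y
        (injective σ′ (begin
          ⟦ σ′ ⟧ (⟦ τ ⟧ ζ)                    ≈⟨ σ′τ ζ ⟩
          ⟦ σ ⟧ ζ                             ≈⟨ σζ≈ ⟩
          ζ ^ (c ℕ.+ p ℕ.* s)                 ≈⟨ ζ^-periodic (c ℕ.+ p ℕ.* s) z ⟨
          ζ ^ (c ℕ.+ p ℕ.* s ℕ.+ M ℕ.* z)     ≡⟨ ≡.cong (ζ ^_) eq ⟨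
          ζ ^ (c ℕ.* (1 ℕ.+ p ℕ.* y))         ≈⟨ ^-assocʳ ζ c _ ⟨
          (ζ ^ c) ^ (1 ℕ.+ p ℕ.* y)           ≈⟨ ^-congˡ (1 ℕ.+ p ℕ.* y) σ′ζ≈ ⟨
          ⟦ σ′ ⟧ ζ ^ (1 ℕ.+ p ℕ.* y)          ≈⟨ ^-homo σ′ ζ (1 ℕ.+ p ℕ.* y) ⟨
          ⟦ σ′ ⟧ (ζ ^ (1 ℕ.+ p ℕ.* y))        ∎))
        (λ x → injective σ′ (trans (σ′τ (incl x)) (agree x)))
      where
      τ : Automorphism L
      τ = (σ′ G.⁻¹) G.∙ σ
      σ′τ : ∀ x → ⟦ σ′ ⟧ (⟦ τ ⟧ x) ≈ ⟦ σ ⟧ x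
      σ′τ x = G.inverseʳ σ′ (⟦ σ ⟧ x)

open ≡ using (refl; sym; trans; cong; cong₂; subst)

-- Equivalence of cusps under Γ₁(p)

pos-+-* : ∀ i j k → + (i ℕ.+ j ℕ.* k) ≡ + i ℤ.+ + j ℤ.* + k
pos-+-* i j k = trans (ℤₚ.pos-+ i (j ℕ.* k)) (cong (λ z → + i ℤ.+ z) (ℤₚ.pos-* j k))

-- Completes the column (a, m) to an integral matrix of determinant 1 with second column (x, y);
-- negative entries absorb the other sign case of Bézout.
coprime⇒determinant-1 : ∀ {a m} → Coprime a m → ∃₂ λ x y → + a ℤ.* y ℤ.- + m ℤ.* x ≡ 1ℤ
coprime⇒determinant-1 {a} {m} cop with Coprimality.coprime-Bézout cop
... | Bézout.+- x y eq = + y , + x ,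
  trans (cong (λ z → z ℤ.- + m ℤ.* + y) (trans (ℤₚ.*-comm (+ a) (+ x)) (trans (sym (ℤₚ.pos-* x a))
          (trans (cong +_ (sym eq)) (pos-+-* 1 y m)))))
        (step (+ y) (+ m))
  where
  step : ∀ y m → 1ℤ ℤ.+ y ℤ.* m ℤ.- m ℤ.* y ≡ 1ℤ
  step = ℤ-Solver.solve-∀
... | Bézout.-+ x y eq = ℤ.- + y , ℤ.- + x ,
  trans (rearrange (+ x) (+ y) (+ a) (+ m))
    (trans (cong (λ z → z ℤ.- + x ℤ.* + a)
      (trans (sym (ℤₚ.pos-* y m)) (trans (cong +_ (sym eq)) (pos-+-* 1 x a))))
           (step (+ x) (+ a)))
  where
  rearrange : ∀ x y a m → a ℤ.* (ℤ.- x) ℤ.- m ℤ.* (ℤ.- y) ≡ y ℤ.* m ℤ.- x ℤ.* a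
  rearrange = ℤ-Solver.solve-∀
  step : ∀ x a → 1ℤ ℤ.+ x ℤ.* a ℤ.- x ℤ.* a ≡ 1ℤ
  step = ℤ-Solver.solve-∀

-- With A and B of determinant 1 and first columns (a , p k) and (b , p), the
-- matrix A B⁻¹ carries b/p to a/(p k); it lies in Γ₁(p) when a ≡ b mod p.
module Transport (p : ℕ) (b k t x y x′ y′ : ℤ)
  (det-B : b ℤ.* y ℤ.- + p ℤ.* x ≡ 1ℤ)
  (det-A : (b ℤ.+ + p ℤ.* t) ℤ.* y′ ℤ.- (+ p ℤ.* k) ℤ.* x′ ≡ 1ℤ) where

  private
    a m P : ℤ
    P = + p
    a = b ℤ.+ P ℤ.* t
    m = P ℤ.* k

  transport : Γ₁ p
  transport = record
    { a = a ℤ.* y ℤ.- x′ ℤ.* P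
    ; b = x′ ℤ.* b ℤ.- a ℤ.* x
    ; c = m ℤ.* y ℤ.- y′ ℤ.* P
    ; d = y′ ℤ.* b ℤ.- m ℤ.* x
    ; det = trans (det a b m P x y x′ y′) (cong₂ ℤ._*_ det-A det-B)
    -- The 1 is rewritten as a determinant, `det-B` for this entry and `det-A` for the lower right
    -- one; then a = b + P t and m = P k exhibit the factor P.
    ; a≡1 = congruent (ℤ∣.divides (t ℤ.* y ℤ.- x′ ℤ.+ x)
              (trans (cong (λ z → a ℤ.* y ℤ.- x′ ℤ.* P ℤ.- z) (sym det-B)) (a≡1 b P t x y x′)))
    ; d≡1 = congruent (ℤ∣.divides (k ℤ.* x′ ℤ.- y′ ℤ.* t ℤ.- k ℤ.* x)
              (trans (cong (λ z → y′ ℤ.* b ℤ.- m ℤ.* x ℤ.- z) (sym det-A)) (d≡1 b P t k x x′ y′)))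
    ; c≡0 = congruent (ℤ∣.divides (k ℤ.* y ℤ.- y′) (c≡0 P k y y′))
    }
    where
    det : ∀ a b m P x y x′ y′ →
      (a ℤ.* y ℤ.- x′ ℤ.* P) ℤ.* (y′ ℤ.* b ℤ.- m ℤ.* x) ℤ.- (x′ ℤ.* b ℤ.- a ℤ.* x) ℤ.*
        (m ℤ.* y ℤ.- y′ ℤ.* P)
        ≡ (a ℤ.* y′ ℤ.- m ℤ.* x′) ℤ.* (b ℤ.* y ℤ.- P ℤ.* x)
    det = ℤ-Solver.solve-∀
    a≡1 : ∀ b P t x y x′ →
      (b ℤ.+ P ℤ.* t) ℤ.* y ℤ.- x′ ℤ.* P ℤ.- (b ℤ.* y ℤ.- P ℤ.* x) ≡ (t ℤ.* y ℤ.- x′ ℤ.+ x) ℤ.* P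
    a≡1 = ℤ-Solver.solve-∀
    d≡1 : ∀ b P t k x x′ y′ →
      y′ ℤ.* b ℤ.- P ℤ.* k ℤ.* x ℤ.- ((b ℤ.+ P ℤ.* t) ℤ.* y′ ℤ.- P ℤ.* k ℤ.* x′)
        ≡ (k ℤ.* x′ ℤ.- y′ ℤ.* t ℤ.- k ℤ.* x) ℤ.* P
    d≡1 = ℤ-Solver.solve-∀
    c≡0 : ∀ P k y y′ → P ℤ.* k ℤ.* y ℤ.- y′ ℤ.* P ℤ.- 0ℤ ≡ (k ℤ.* y ℤ.- y′) ℤ.* P
    c≡0 = ℤ-Solver.solve-∀

  open ℙ¹ℚ

  -- Stated for any z with these coordinates, because `_/ᶜ_` matches on its denominator and does not
  -- compute at a variable p.
  transport-num : ∀ {z} → num z ≡ b → den z ≡ P → num (transport • z) ≡ a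
  transport-num {z} refl refl = trans (identity a b P x y x′)
    (trans (cong (a ℤ.*_) det-B) (ℤₚ.*-identityʳ a))
    where
    identity : ∀ a b P x y x′ → (a ℤ.* y ℤ.- x′ ℤ.* P) ℤ.* b ℤ.+ (x′ ℤ.* b ℤ.- a ℤ.* x) ℤ.* P
      ≡ a ℤ.* (b ℤ.* y ℤ.- P ℤ.* x)
    identity = ℤ-Solver.solve-∀

  transport-den : ∀ {z} → num z ≡ b → den z ≡ P → den (transport • z) ≡ m
  transport-den {z} refl refl = trans (identity b m P x y y′)
    (trans (cong (m ℤ.*_) det-B) (ℤₚ.*-identityʳ m))
    where
    identity : ∀ b m P x y y′ → (m ℤ.* y ℤ.- y′ ℤ.* P) ℤ.* b ℤ.+ (y′ ℤ.* b ℤ.- m ℤ.* x) ℤ.* P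
      ≡ m ℤ.* (b ℤ.* y ℤ.- P ℤ.* x)
    identity = ℤ-Solver.solve-∀

num-/ᶜ : ∀ a m .{{_ : NonZero m}} → ℙ¹ℚ.num (a /ᶜ m) ≡ a
num-/ᶜ a (suc m) = refl

den-/ᶜ : ∀ a m .{{_ : NonZero m}} → ℙ¹ℚ.den (a /ᶜ m) ≡ + m
den-/ᶜ a (suc m) = refl

module _ {p : ℕ} .{{_ : NonZero p}} (Φ : BoundarySymbol p p) where
  open BoundarySymbol Φ
  open CommutativeRing (ℤ/ p) using (_≈_) renaming (trans to ≈-trans; sym to ≈-sym)

  -- `transport` hits numerator and denominator exactly, so `φ-cong` applies at once. For k = pⁿ the
  -- product `p * k` is pⁿ⁺¹ by definition.
  φ-level : ∀ {a b t k} .{{_ : NonZero (p ℕ.* k)}} → a ≡ b ℕ.+ p ℕ.* t →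
            Coprime a (p ℕ.* k) → Coprime b p → φ ((+ a) /ᶜ (p ℕ.* k)) ≈ φ ((+ b) /ᶜ p)
  φ-level {a} {b} {t} {k} a≡ cop-a cop-b
    with x′ , y′ , det-A ← coprime⇒determinant-1 cop-a
       | x , y , det-B ← coprime⇒determinant-1 cop-b =
    ≈-trans (φ-cong (≈ᶜ-intro {(+ a) /ᶜ (p ℕ.* k)} {transport • z}
      (trans (num-/ᶜ (+ a) (p ℕ.* k)) (trans +a≡ (sym (transport-num {z} z-num z-den))))
      (trans (den-/ᶜ (+ a) (p ℕ.* k))
        (trans (ℤₚ.pos-* p k) (sym (transport-den {z} z-num z-den))))))
      (invariant transport z)
    where
    z = (+ b) /ᶜ p
    z-num = num-/ᶜ (+ b) p
    z-den = den-/ᶜ (+ b) p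
    +a≡ : + a ≡ + b ℤ.+ + p ℤ.* + t
    +a≡ = trans (cong +_ a≡) (pos-+-* b p t)
    open Transport p (+ b) (+ k) (+ t) x y x′ y′ det-B
      (trans (cong₂ (λ u v → u ℤ.* y′ ℤ.- v ℤ.* x′) (sym +a≡) (sym (ℤₚ.pos-* p k))) det-A)
    ≈ᶜ-intro : ∀ {u v} → ℙ¹ℚ.num u ≡ ℙ¹ℚ.num v → ℙ¹ℚ.den u ≡ ℙ¹ℚ.den v → u ≈ᶜ v
    ≈ᶜ-intro num≡ den≡ = cong₂ ℤ._*_ num≡ (sym den≡)

-- Coefficients of (x - 1)ᵏ modulo p

-- The coefficient of xⁱ in (x - 1)ᵏ.
signedBinomial : ℕ → ℕ → ℤ
signedBinomial zero    zero    = 1ℤ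
signedBinomial zero    (suc i) = 0ℤ
signedBinomial (suc k) zero    = ℤ.- signedBinomial k zero
signedBinomial (suc k) (suc i) = signedBinomial k i ℤ.- signedBinomial k (suc i)

signedBinomial-> : ∀ {k i} → k ℕ.< i → signedBinomial k i ≡ 0ℤ
signedBinomial-> {zero}  {suc i} k<i = refl
signedBinomial-> {suc k} {suc i} k<i = cong₂ ℤ._-_
  (signedBinomial-> (ℕ.s<s⁻¹ k<i)) (signedBinomial-> (ℕₚ.<-trans (ℕₚ.n<1+n k) k<i))

signedBinomial-diagonal : ∀ k → signedBinomial k k ≡ 1ℤ
signedBinomial-diagonal zero    = refl
signedBinomial-diagonal (suc k) = cong₂ ℤ._-_ (signedBinomial-diagonal k)
  (signedBinomial-> (ℕₚ.n<1+n k))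

-- The coefficient of xⁱ in the derivative of (x - 1)^(k+1), computed in two ways.
signedBinomial-absorption : ∀ k i →
  + suc i ℤ.* signedBinomial (suc k) (suc i) ≡ + suc k ℤ.* signedBinomial k i
signedBinomial-absorption zero    zero    = refl
signedBinomial-absorption zero    (suc i) = ℤₚ.*-zeroʳ (+ suc (suc i))
signedBinomial-absorption (suc k) zero    =
  trans (step₁ (signedBinomial k 0) (signedBinomial (suc k) 1))
    (trans (cong (λ z → ℤ.- signedBinomial k 0 ℤ.- z) (signedBinomial-absorption k 0))
           (step₂ (signedBinomial k 0) (+ suc k)))
  where
  step₁ : ∀ c d → 1ℤ ℤ.* (ℤ.- c ℤ.- d) ≡ ℤ.- c ℤ.- 1ℤ ℤ.* d
  step₁ = ℤ-Solver.solve-∀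
  step₂ : ∀ c s → ℤ.- c ℤ.- s ℤ.* c ≡ (1ℤ ℤ.+ s) ℤ.* (ℤ.- c)
  step₂ = ℤ-Solver.solve-∀
signedBinomial-absorption (suc k) (suc i) =
  trans (step₁ (+ suc i) (signedBinomial (suc k) (suc i)) (signedBinomial (suc k) (suc (suc i))))
    (trans (cong₂ (λ y z → signedBinomial (suc k) (suc i) ℤ.+ y ℤ.- z)
             (signedBinomial-absorption k i) (signedBinomial-absorption k (suc i)))
           (step₂ (+ suc k) (signedBinomial k i) (signedBinomial k (suc i))))
  where
  step₁ : ∀ s c d → (1ℤ ℤ.+ s) ℤ.* (c ℤ.- d) ≡ c ℤ.+ s ℤ.* c ℤ.- (1ℤ ℤ.+ s) ℤ.* d
  step₁ = ℤ-Solver.solve-∀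
  step₂ : ∀ s c d → (c ℤ.- d) ℤ.+ s ℤ.* c ℤ.- s ℤ.* d ≡ (1ℤ ℤ.+ s) ℤ.* (c ℤ.- d)
  step₂ = ℤ-Solver.solve-∀

module _ {p : ℕ} (prime : Prime p) where

  private instance
    p≢0 : NonZero p
    p≢0 = prime⇒nonZero prime

  -- By absorption pⁿ divides (i + 1) times the coefficient; were the coefficient prime to p, pⁿ
  -- would divide i + 1, which is smaller than pⁿ.
  p∣signedBinomial : ∀ {n k i} → suc k ≡ p ℕ.^ n → i ℕ.< k →
                     (+ p) ℤ∣ᵤ.∣ signedBinomial (suc k) (suc i)
  p∣signedBinomial {n} {k} {i} sk≡ i<k with p ℕ∣.∣? ℤ.∣ signedBinomial (suc k) (suc i) ∣
  ... | yes p∣c = p∣c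
  ... | no p∤c = contradiction
      (Coprimality.coprime-divisor (Coprimality.sym (∤⇒coprime-^ prime n p∤c))
        (ℕ∣.divides ℤ.∣ signedBinomial k i ∣ absorbed))
      (ℕ∣.>⇒∤ (subst (suc i ℕ.<_) sk≡ (s≤s i<k)))
    where
    absorbed : ℤ.∣ signedBinomial (suc k) (suc i) ∣ ℕ.* suc i ≡ ℤ.∣ signedBinomial k i ∣ ℕ.* p ℕ.^ n
    absorbed = trans (ℕₚ.*-comm _ (suc i))
      (trans (sym (ℤₚ.abs-* (+ suc i) (signedBinomial (suc k) (suc i))))
      (trans (cong ℤ.∣_∣ (signedBinomial-absorption k i))
        (trans (ℤₚ.abs-* (+ suc k) (signedBinomial k i))
        (trans (ℕₚ.*-comm (suc k) _) (cong (ℤ.∣ signedBinomial k i ∣ ℕ.*_) sk≡)))))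

  module ℤ/p = CommutativeRing (ℤ/ p)

  -- Descent from the leading coefficient, `d` being the distance to it: neighbours differ by a
  -- middle coefficient of (x - 1)^(pⁿ), which is 0 mod p.
  signedBinomial-[p^n-1] : ∀ {n k} → suc k ≡ p ℕ.^ n → ∀ d i → d ℕ.+ i ≡ k
    → signedBinomial k i ℤ/p.≈ 1ℤ
  signedBinomial-[p^n-1] {n} {k} sk≡ zero    i refl = ℤ/p.reflexive (signedBinomial-diagonal k)
  signedBinomial-[p^n-1] {n} {k} sk≡ (suc d) i d+i≡ = ℤ/p.trans
    (congruent (ℤ∣.∣ᵤ⇒∣ (p∣signedBinomial {n} sk≡ (subst (i ℕ.<_) d+i≡ (s≤s (ℕₚ.m≤n+m i d))))))
    (signedBinomial-[p^n-1] {n} sk≡ d (suc i) (trans (ℕₚ.+-suc d i) d+i≡))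

-- Permutations and finite sums

injective⇒permutation : ∀ {n} (f : Fin n → Fin n) → Injective _≡_ _≡_ f →
                        ∃ λ (π : Permutation′ n) → ∀ i → π ⟨$⟩ʳ i ≡ f i
injective⇒permutation {n} f inj =
  permutation f (λ i → proj₁ (surj i)) (λ i → proj₂ (surj i))
    (λ i → inj (proj₂ (surj (f i)))) , λ _ → refl
  where
  surjective : ∀ {n} (f : Fin n → Fin n) → Injective _≡_ _≡_ f → ∀ i → ∃ λ j → f j ≡ i
  surjective {suc n} f inj i with any? (λ j → f j Finₚ.≟ i)
  ... | yes found = found
  ... | no none = contradiction
      (Finₚ.injective⇒≤ {f = λ j → punchOut (missed j)}
        (λ {j} {j′} eq → inj (Finₚ.punchOut-injective (missed j) (missed j′) eq)))
      ℕₚ.1+n≰n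
    where
    missed : ∀ j → i ≢ f j
    missed j i≡fj = none (j , sym i≡fj)
  surj = surjective f inj

module SumProperties {a ℓ} (M : CommutativeMonoid a ℓ) where
  open CommutativeMonoid M renaming (refl to ≈-refl; sym to ≈-sym; trans to ≈-trans)
  open Algebra.Properties.CommutativeMonoid.Sum M public

  sum-++ : ∀ m {n} (f : Fin (m ℕ.+ n) → Carrier) →
           sum f ≈ sum (λ i → f (i ↑ˡ n)) ∙ sum (λ j → f (m ↑ʳ j))
  sum-++ zero    f = ≈-sym (identityˡ _)
  sum-++ (suc m) f = ≈-trans (∙-congˡ (sum-++ m (λ i → f (suc i)))) (≈-sym (assoc _ _ _))

  sum-combine : ∀ m n (f : Fin (m ℕ.* n) → Carrier) →
                sum f ≈ sum {m} (λ i → sum {n} (λ j → f (combine i j)))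
  sum-combine zero    n f = ≈-refl
  sum-combine (suc m) n f = ≈-trans (sum-++ n f) (∙-congˡ (sum-combine m n (λ i → f (n ↑ʳ i))))

  sum-cast : ∀ {m n} (eq : m ≡ n) (f : Fin n → Carrier) → sum f ≈ sum (λ i → f (cast eq i))
  sum-cast refl f = sum-cong-≋ (λ i → reflexive (cong f (sym (Finₚ.cast-is-id refl i))))

-- Computation with formal sums and polynomials in γ

module GroupRingProperties {r ℓr g ℓg} (R : CommutativeRing r ℓr) (G : Group g ℓg) where
  private
    module R = CommutativeRing R
    module G = Group G
  open GroupRing R G
  open Powers G

  ≋-reflexive : ∀ {F H} → F ≡ H → F ≋ H
  ≋-reflexive refl = ≋-refl

  ++-congˡ : ∀ F {H H′} → H ≋ H′ → F ++ H ≋ F ++ H′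
  ++-congˡ []      eq = eq
  ++-congˡ (_ ∷ F) eq = ≋-cons R.refl G.refl (++-congˡ F eq)

  ++-congʳ : ∀ {F F′ H} → F ≋ F′ → F ++ H ≋ F′ ++ H
  ++-congʳ ≋-refl            = ≋-refl
  ++-congʳ (≋-sym eq)        = ≋-sym (++-congʳ eq)
  ++-congʳ (≋-trans eq eq′)  = ≋-trans (++-congʳ eq) (++-congʳ eq′)
  ++-congʳ (≋-cons r x eq)   = ≋-cons r x (++-congʳ eq)
  ++-congʳ ≋-swap            = ≋-swap
  ++-congʳ ≋-merge           = ≋-merge
  ++-congʳ ≋-drop            = ≋-drop

  ++-shift : ∀ F {t H} → F ++ t ∷ H ≋ t ∷ F ++ H
  ++-shift []      = ≋-refl
  ++-shift (_ ∷ F) = ≋-trans (≋-cons R.refl G.refl (++-shift F)) ≋-swap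

  ++-comm : ∀ F H → F ++ H ≋ H ++ F
  ++-comm []      H = ≋-reflexive (sym (Listₚ.++-identityʳ H))
  ++-comm (t ∷ F) H = ≋-trans (≋-cons R.refl G.refl (++-comm F H)) (≋-sym (++-shift H))

  ++-commutativeMonoid : CommutativeMonoid _ _
  ++-commutativeMonoid = record
    { Carrier = FormalSum ; _≈_ = _≋_ ; _∙_ = _++_ ; ε = []
    ; isCommutativeMonoid = record
      { isMonoid = record
        { isSemigroup = record
          { isMagma = record
            { isEquivalence = record { refl = ≋-refl ; sym = ≋-sym ; trans = ≋-trans }
            ; ∙-cong = λ {F} {F′} {H} eq eq′ → ≋-trans (++-congʳ eq) (++-congˡ F′ eq′)
            }
          ; assoc = λ F H I → ≋-reflexive (Listₚ.++-assoc F H I)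
          }
        ; identity = (λ _ → ≋-refl) , (λ F → ≋-reflexive (Listₚ.++-identityʳ F))
        }
      ; comm = ++-comm
      }
    }

  open CommutativeMonoid ++-commutativeMonoid public using (setoid)
    renaming (∙-cong to ++-cong)
  open SumProperties ++-commutativeMonoid public using
    (sum-cong-≋; sum-replicate-zero; sum-init-last; sum-permute; sum-combine; sum-cast; ∑-comm)
  open Relation.Binary.Reasoning.Setoid setoid

  -- Left multiplication by one term. `_⊛_` unfolds into such pieces, so multiplying by T is, by
  -- computation, a concatenation of two of them.
  translate : R.Carrier × G.Carrier → FormalSum → FormalSum
  translate t = List.map (Product.zip R._*_ G._∙_ t)

  translate-cong : ∀ t {F H} → F ≋ H → translate t F ≋ translate t H
  translate-cong t ≋-refl           = ≋-refl
  translate-cong t (≋-sym eq)       = ≋-sym (translate-cong t eq)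
  translate-cong t (≋-trans eq eq′) = ≋-trans (translate-cong t eq) (translate-cong t eq′)
  translate-cong (s , y) (≋-cons r x eq)  = ≋-cons (R.*-congˡ {s} r) (G.∙-congˡ x)
    (translate-cong (s , y) eq)
  translate-cong t ≋-swap           = ≋-swap
  translate-cong (s , y) (≋-merge {r} {r′}) =
    ≋-trans ≋-merge (≋-cons (R.sym (R.distribˡ s r r′)) G.refl ≋-refl)
  translate-cong (s , y) ≋-drop     = ≋-trans (≋-cons (R.zeroʳ s) G.refl ≋-refl) ≋-drop

  scale-cong : ∀ s {F H} → F ≋ H → scale s F ≋ scale s H
  scale-cong s ≋-refl           = ≋-refl
  scale-cong s (≋-sym eq)       = ≋-sym (scale-cong s eq)
  scale-cong s (≋-trans eq eq′) = ≋-trans (scale-cong s eq) (scale-cong s eq′)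
  scale-cong s (≋-cons r x eq)  = ≋-cons (R.*-congˡ {s} r) x (scale-cong s eq)
  scale-cong s ≋-swap           = ≋-swap
  scale-cong s (≋-merge {r} {r′}) =
    ≋-trans ≋-merge (≋-cons (R.sym (R.distribˡ s r r′)) G.refl ≋-refl)
  scale-cong s ≋-drop           = ≋-trans (≋-cons (R.zeroʳ s) G.refl ≋-refl) ≋-drop

  scale-0 : ∀ F → scale R.0# F ≋ []
  scale-0 []            = ≋-refl
  scale-0 ((r , x) ∷ F) = ≋-trans (≋-cons (R.zeroˡ r) G.refl (scale-0 F)) ≋-drop

module Polynomials {r ℓr g ℓg} (R : CommutativeRing r ℓr) (G : Group g ℓg)
                   (γ : Group.Carrier G) where
  private
    module R = CommutativeRing R
    module G = Group G
    module Σ = Algebra.Properties.CommutativeMonoid.Sum R.+-commutativeMonoid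
  open GroupRing R G
  open GroupRingProperties R G
  open Powers G
  open Relation.Binary.Reasoning.Setoid setoid

  -- Σ c i γⁱ over i < k with the top power first, so that `suc k` adds one term in front. Exponents
  -- are not reduced by the order of γ.
  polynomial : (ℕ → R.Carrier) → ℕ → FormalSum
  polynomial c zero    = []
  polynomial c (suc k) = (c k , γ ↑ k) ∷ polynomial c k

  polynomial-cong : ∀ {c d} k → (∀ {i} → i ℕ.< k → c i R.≈ d i) → polynomial c k ≋ polynomial d k
  polynomial-cong zero    eq = ≋-refl
  polynomial-cong (suc k) eq = ≋-cons (eq (ℕₚ.n<1+n k)) G.refl
    (polynomial-cong k (λ i<k → eq (ℕₚ.<-trans i<k (ℕₚ.n<1+n k))))

  polynomial-+ : ∀ c d k → polynomial c k ++ polynomial d k ≋ polynomial (λ i → c i R.+ d i) k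
  polynomial-+ c d zero    = ≋-refl
  polynomial-+ c d (suc k) = ≋-trans (≋-cons R.refl G.refl (++-shift (polynomial c k)))
    (≋-trans ≋-merge (≋-cons R.refl G.refl (polynomial-+ c d k)))

  polynomial-0 : ∀ k → polynomial (λ _ → R.0#) k ≋ []
  polynomial-0 zero    = ≋-refl
  polynomial-0 (suc k) = ≋-trans ≋-drop (polynomial-0 k)

  polynomial-sum : ∀ {m} (c : Fin m → R.Carrier) k →
    sum (λ b → polynomial (λ _ → c b) k) ≋ polynomial (λ _ → Σ.sum c) k
  polynomial-sum {zero}  c k = ≋-sym (polynomial-0 k)
  polynomial-sum {suc m} c k = ≋-trans
    (++-congˡ (polynomial (λ _ → c zero) k) (polynomial-sum (λ b → c (suc b)) k))
    (polynomial-+ (λ _ → c zero) (λ _ → Σ.sum (λ b → c (suc b))) k)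

  scale-polynomial : ∀ s c k → scale s (polynomial c k) ≋ polynomial (λ i → s R.* c i) k
  scale-polynomial s c zero    = ≋-refl
  scale-polynomial s c (suc k) = ≋-cons R.refl G.refl (scale-polynomial s c k)

  -- `sum` lists the exponents upwards and `polynomial` downwards, hence the split at the last index
  -- and the commutation.
  sum-constant-powers : ∀ s k → sum {k} (λ i → (s , γ ↑ toℕ i) ∷ []) ≋ polynomial (λ _ → s) k
  sum-constant-powers s zero    = ≋-refl
  sum-constant-powers s (suc k) = begin
    sum {suc k} (λ i → (s , γ ↑ toℕ i) ∷ [])
      ≈⟨ sum-init-last {k} (λ i → (s , γ ↑ toℕ i) ∷ []) ⟩
    sum {k} (λ i → (s , γ ↑ toℕ (inject₁ i)) ∷ []) ++ (s , γ ↑ toℕ (fromℕ k)) ∷ []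
      ≡⟨ cong (λ j → sum {k} (λ i → (s , γ ↑ toℕ (inject₁ i)) ∷ []) ++ (s , γ ↑ j) ∷ [])
        (Finₚ.toℕ-fromℕ k) ⟩
    sum {k} (λ i → (s , γ ↑ toℕ (inject₁ i)) ∷ []) ++ (s , γ ↑ k) ∷ []
      ≈⟨ ++-congʳ (≋-trans (sum-cong-≋ {k}
        (λ i → ≋-reflexive (cong (λ j → (s , γ ↑ j) ∷ []) (Finₚ.toℕ-inject₁ i))))
          (sum-constant-powers s k)) ⟩
    polynomial (λ _ → s) k ++ (s , γ ↑ k) ∷ []
      ≈⟨ ++-comm (polynomial (λ _ → s) k) _ ⟩
    polynomial (λ _ → s) (suc k) ∎

  shift : (ℕ → R.Carrier) → ℕ → R.Carrier
  shift c zero    = R.0#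
  shift c (suc i) = c i

  translate-γ : ∀ c k → translate (R.1# , γ) (polynomial c k) ≋ polynomial (shift c) (suc k)
  translate-γ c zero    = ≋-sym ≋-drop
  translate-γ c (suc k) = ≋-cons (R.*-identityˡ (c k)) G.refl (translate-γ c k)

  translate-ε : ∀ s c k → translate (s , G.ε) (polynomial c k) ≋ polynomial (λ i → s R.* c i) k
  translate-ε s c zero    = ≋-refl
  translate-ε s c (suc k) = ≋-cons R.refl (G.identityˡ _) (translate-ε s c k)

-- The norm element and its λ-invariant

module NormElement {g ℓg} (p : ℕ) (G : Group g ℓg) (γ : Group.Carrier G) where
  private
    module R = CommutativeRing (ℤ/ p)
    module G = Group G
  open GroupRing (ℤ/ p) G
  open GroupRingProperties (ℤ/ p) G
  open Polynomials (ℤ/ p) G γ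
  open Relation.Binary.Reasoning.Setoid setoid

  module _ (N : ℕ) where
    open Lambda (ℤ/ p) G N γ

    -- Multiplication by γ - 1 acts on coefficient sequences by Pascal's rule, the recursion that
    -- defines `signedBinomial`.
    T^ : ∀ k → T ^ k ≋ polynomial (signedBinomial k) (suc k)
    T^ zero    = ≋-refl
    T^ (suc k) = begin
      translate (R.1# , γ) (T ^ k) ++ translate (-1# , G.ε) (T ^ k) ++ []
        ≡⟨ cong (translate (R.1# , γ) (T ^ k) ++_)
          (Listₚ.++-identityʳ (translate (-1# , G.ε) (T ^ k))) ⟩
      translate (R.1# , γ) (T ^ k) ++ translate (-1# , G.ε) (T ^ k)
        ≈⟨ ++-cong (translate-cong (R.1# , γ) (T^ k)) (translate-cong (-1# , G.ε) (T^ k)) ⟩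
      translate (R.1# , γ) (polynomial c (suc k)) ++ translate (-1# , G.ε) (polynomial c (suc k))
        ≈⟨ ++-cong (translate-γ c (suc k)) (translate-ε -1# c (suc k)) ⟩
      polynomial (shift c) (suc (suc k)) ++ polynomial (λ i → -1# R.* c i) (suc k)
        -- A zero coefficient pads the second polynomial, as `polynomial-+` needs equal lengths.
        ≈⟨ ++-congˡ (polynomial (shift c) (suc (suc k))) pad ⟨
      polynomial (shift c) (suc (suc k)) ++ polynomial (λ i → -1# R.* c i) (suc (suc k))
        ≈⟨ polynomial-+ (shift c) (λ i → -1# R.* c i) (suc (suc k)) ⟩
      polynomial (λ i → shift c i R.+ -1# R.* c i) (suc (suc k))
        ≈⟨ polynomial-cong (suc (suc k)) (λ {i} _ → R.reflexive (pascal i)) ⟩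
      polynomial (signedBinomial (suc k)) (suc (suc k)) ∎
      where
      c = signedBinomial k
      -1# = (R.- R.1#) R.* R.1#
      pad : polynomial (λ i → -1# R.* c i) (suc (suc k)) ≋ polynomial (λ i → -1# R.* c i) (suc k)
      pad = ≋-trans (≋-cons
        (R.reflexive (cong (-1# R.*_) (signedBinomial-> (ℕₚ.n<1+n k)))) G.refl ≋-refl) ≋-drop
      pascal : ∀ i → shift c i R.+ -1# R.* c i ≡ signedBinomial (suc k) i
      pascal zero    = step (c 0)
        where
        step : ∀ x → 0ℤ ℤ.+ ℤ.- 1ℤ ℤ.* x ≡ ℤ.- x
        step = ℤ-Solver.solve-∀
      pascal (suc i) = step (c i) (c (suc i))
        where
        step : ∀ x y → x ℤ.+ ℤ.- 1ℤ ℤ.* y ≡ x ℤ.- y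
        step = ℤ-Solver.solve-∀

    T^[p^n-1] : Prime p → ∀ {n k} → suc k ≡ p ℕ.^ n → T ^ k ≋ polynomial (λ _ → R.1#) (suc k)
    T^[p^n-1] p-prime {n} {k} sk≡ = ≋-trans (T^ k) (polynomial-cong (suc k)
      (λ {i} i≤k → signedBinomial-[p^n-1] p-prime {n} sk≡ (k ℕ.∸ i) i (ℕₚ.m∸n+n≡m (ℕ.s≤s⁻¹ i≤k))))

  module _ {N : ℕ} where
    open Lambda (ℤ/ p) G (suc N) γ

    private
      top : R.Carrier → Fin (suc N) → R.Carrier
      top s i with toℕ i ℕₚ.≟ N
      ... | yes _ = s
      ... | no  _ = R.0#

      top-below : ∀ s i → toℕ i ≢ N → top s i ≡ R.0#
      top-below s i i≢N with toℕ i ℕₚ.≟ N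
      ... | yes i≡N = contradiction i≡N i≢N
      ... | no  _   = refl

      top-last : ∀ s → top s (fromℕ N) ≡ s
      top-last s with toℕ (fromℕ N) ℕₚ.≟ N
      ... | yes _   = refl
      ... | no ≢N = contradiction (Finₚ.toℕ-fromℕ N) ≢N

      expansion-top : ∀ s → expansion (top s) ≋ scale s (T ^ N)
      expansion-top s = begin
        expansion (top s)
          ≈⟨ sum-init-last {N} (λ i → scale (top s i) (T ^ toℕ i)) ⟩
        sum {N} (λ i → scale (top s (inject₁ i)) (T ^ toℕ (inject₁ i))) ++ scale (top s (fromℕ N))
          (T ^ toℕ (fromℕ N))
          ≈⟨ ++-cong (≋-trans (sum-cong-≋ {N} vanish) (sum-replicate-zero N))
               (≋-reflexive (cong₂ (λ r k → scale r (T ^ k)) (top-last s) (Finₚ.toℕ-fromℕ N))) ⟩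
        scale s (T ^ N) ∎
        where
        vanish : ∀ i → scale (top s (inject₁ i)) (T ^ toℕ (inject₁ i)) ≋ []
        vanish i = ≋-trans (≋-reflexive (cong (λ r → scale r (T ^ toℕ (inject₁ i)))
            (top-below s (inject₁ i)
              (ℕₚ.<⇒≢ (subst (ℕ._< N) (sym (Finₚ.toℕ-inject₁ i)) (Finₚ.toℕ<n i))))))
          (scale-0 (T ^ toℕ (inject₁ i)))

    -- F is s times the norm element, hence s Tᴺ, and its expansion has the single coefficient s at
    -- the top index. The number of coefficients is written `suc N` so that this index is N.
    norm-λ-suc : Prime p → ∀ {n F s} → suc N ≡ p ℕ.^ n → ¬ (s R.≈ R.0#) →
                 F ≋ polynomial (λ _ → s) (suc N) → HasLambda F (fin N)
    norm-λ-suc p-prime {n} {F} {s} sN≡ s≉0 F≋ = top s , F≋expansion ,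
      (fromℕ N , Finₚ.toℕ-fromℕ N , λ eq → s≉0 (R.trans (R.reflexive (sym (top-last s))) eq)) ,
      λ j j<N → R.reflexive (top-below s j (ℕₚ.<⇒≢ j<N))
      where
      F≋expansion : F ≋ expansion (top s)
      F≋expansion = begin
        F                                             ≈⟨ F≋ ⟩
        polynomial (λ _ → s) (suc N)
          ≈⟨ polynomial-cong (suc N) (λ _ → R.*-identityʳ s) ⟨
        polynomial (λ _ → s R.* R.1#) (suc N)         ≈⟨ scale-polynomial s (λ _ → R.1#) (suc N) ⟨
        scale s (polynomial (λ _ → R.1#) (suc N))
          ≈⟨ scale-cong s (T^[p^n-1] (suc N) p-prime {n} sN≡) ⟨
        scale s (T ^ N)                               ≈⟨ expansion-top s ⟨
        expansion (top s)                             ∎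

  norm-λ : Prime p → ∀ {N n F s} .{{_ : NonZero N}} → N ≡ p ℕ.^ n → ¬ (s R.≈ R.0#) →
           F ≋ polynomial (λ _ → s) N → Lambda.HasLambda (ℤ/ p) G N γ F (fin (N ℕ.∸ 1))
  norm-λ p-prime {suc N} {n} = norm-λ-suc p-prime {n}

-- The Mazur-Tate element as a multiple of the norm element

-- `toUnit` chooses its own proof of coprimality, so the unit it returns is tracked through its
-- residue; the lemmas on lifted units take such residue equations as hypotheses.
toUnit-coprime : ∀ {N} {a : Fin N} → Coprime (toℕ a) N →
                 ∃ λ u → toUnit a ≡ just u × Unit.residue u ≡ a
toUnit-coprime {N} {a} cop with coprime? (toℕ a) N
... | yes cop′ = unit a cop′ , refl , refl
... | no ¬cop  = contradiction (λ {d} → cop {d}) ¬cop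

toUnit-¬coprime : ∀ {N} {a : Fin N} → ¬ Coprime (toℕ a) N → toUnit a ≡ nothing
toUnit-¬coprime {N} {a} ¬cop with coprime? (toℕ a) N
... | yes cop = contradiction (λ {d} → cop {d}) ¬cop
... | no _    = refl

module _ {c ℓ c′ ℓ′ : Level} {p : ℕ} .{{_ : NonZero p}} (prime : Prime p) (2∤p : ¬ (2 ℕ∣.∣ p))
  (n : ℕ)
  (S : CyclotomicLayer p (suc n) c ℓ c′ ℓ′) (Φ : BoundarySymbol p p) where

  open CyclotomicLayer S
  open BoundarySymbol Φ
  private
    N M : ℕ
    N = p ℕ.^ suc n
    M = p ℕ.^ suc (suc n)
    module R = CommutativeRing (ℤ/ p)
    module G = Group (Gal K)
    module L = Extension L
    module RΣ = Algebra.Properties.CommutativeMonoid.Sum R.+-commutativeMonoid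
    instance
      M≢0 : NonZero M
      M≢0 = ℕₚ.m^n≢0 p (suc (suc n))
      N≢0 : NonZero N
      N≢0 = ℕₚ.m^n≢0 p (suc n)

  open GroupRing (ℤ/ p) (Gal K)
  open GroupRingProperties (ℤ/ p) (Gal K)
  open Powers (Gal K)

  -- Residues mod M are b + p t, so a fixed b runs through a class mod p. `combine` indexes by N p
  -- while M is p N, hence the cast.
  lift : Fin p → Fin N → Fin M
  lift b t = cast (ℕₚ.*-comm N p) (combine t b)

  toℕ-lift : ∀ b t → toℕ (lift b t) ≡ toℕ b ℕ.+ p ℕ.* toℕ t
  toℕ-lift b t = trans (Finₚ.toℕ-cast (ℕₚ.*-comm N p) (combine t b))
    (trans (Finₚ.toℕ-combine t b) (ℕₚ.+-comm _ (toℕ b)))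

  p∣lift⇒p∣ : ∀ b t → p ℕ∣.∣ toℕ (lift b t) → p ℕ∣.∣ toℕ b
  p∣lift⇒p∣ b t d = ℕ∣.∣m+n∣m⇒∣n (subst (p ℕ∣.∣_) (trans (toℕ-lift b t) (ℕₚ.+-comm (toℕ b) _)) d)
    (ℕ∣.m∣m*n (toℕ t))

  p∣⇒p∣lift : ∀ b t → p ℕ∣.∣ toℕ b → p ℕ∣.∣ toℕ (lift b t)
  p∣⇒p∣lift b t d = subst (p ℕ∣.∣_) (sym (toℕ-lift b t)) (ℕ∣.∣m∣n⇒∣m+n d (ℕ∣.m∣m*n (toℕ t)))

  lift-coprime : ∀ b t → Coprime (toℕ b) p → Coprime (toℕ (lift b t)) M
  lift-coprime b t cop = ∤⇒coprime-^ prime (suc (suc n)) λ d →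
    coprime-^⇒∤ prime 0 (subst (Coprime (toℕ b)) (sym (ℕₚ.*-identityʳ p)) cop) (p∣lift⇒p∣ b t d)

  lift-¬coprime : ∀ b t → ¬ Coprime (toℕ b) p → ¬ Coprime (toℕ (lift b t)) M
  lift-¬coprime b t ¬cop cop = ¬cop
    (∤⇒coprime prime λ d → coprime-^⇒∤ prime (suc n) cop (p∣⇒p∣lift b t d))

  coefficient-level : ∀ {b : Unit p} {t} {u : Unit M} → Unit.residue u ≡ lift (Unit.residue b) t →
                      coefficient Φ M u R.≈ coefficient Φ p b
  coefficient-level {b} {t} {u} eq = R.+-congˡ {φ ∞ᶜ} (R.-‿cong
    (φ-level Φ {t = toℕ t} {k = N} (trans (cong toℕ eq) (toℕ-lift (Unit.residue b) t))
      (Unit.coprime u) (Unit.coprime b)))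

  open Cyclotomic prime n L cyclotomic using (module Subfield)
  open Subfield embedding degree using (separates)

  -- `separates` wants a positive difference t - t′ in ℕ, hence the ordering; `restrict-σ-injective`
  -- removes it by symmetry.
  restrict-σ-distinct : ∀ {b t t′} {u u′ : Unit M} →
    Unit.residue u ≡ lift b t → Unit.residue u′ ≡ lift b t′ →
    toℕ t′ ℕ.< toℕ t → ¬ (restrict (σ u) G.≈ restrict (σ u′))
  restrict-σ-distinct {b} {t} {t′} {u} {u′} u≡ u′≡ t′<t eq =
    separates {σ u} {σ u′} {rep u′} {toℕ t ℕ.∸ toℕ t′} 2∤p (Unit.coprime u′)
      (ℕₚ.m<n⇒0<n∸m t′<t) (ℕₚ.≤-<-trans (ℕₚ.m∸n≤m (toℕ t) (toℕ t′)) (Finₚ.toℕ<n t))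
      (L.trans (σ-ζ u) (L.reflexive (cong (ζ L.^_) rep≡))) (σ-ζ u′)
      (λ x → L.trans (L.sym (restrict-≈ (σ u) x))
        (L.trans (incl-cong (eq x)) (restrict-≈ (σ u′) x)))
    where
    open EmbeddingProperties embedding using () renaming (⟦⟧-cong to incl-cong)
    rep≡ : rep u ≡ rep u′ ℕ.+ p ℕ.* (toℕ t ℕ.∸ toℕ t′)
    rep≡ = begin
      rep u
        ≡⟨ trans (cong toℕ u≡) (toℕ-lift b t) ⟩
      toℕ b ℕ.+ p ℕ.* toℕ t
        ≡⟨ cong (λ k → toℕ b ℕ.+ p ℕ.* k) (ℕₚ.m+[n∸m]≡n (ℕₚ.<⇒≤ t′<t)) ⟨
      toℕ b ℕ.+ p ℕ.* (toℕ t′ ℕ.+ (toℕ t ℕ.∸ toℕ t′))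
        ≡⟨ regroup (toℕ b) p (toℕ t′) (toℕ t ℕ.∸ toℕ t′) ⟩
      toℕ b ℕ.+ p ℕ.* toℕ t′ ℕ.+ p ℕ.* (toℕ t ℕ.∸ toℕ t′)
        ≡⟨ cong (ℕ._+ p ℕ.* (toℕ t ℕ.∸ toℕ t′)) (trans (cong toℕ u′≡) (toℕ-lift b t′)) ⟨
      rep u′ ℕ.+ p ℕ.* (toℕ t ℕ.∸ toℕ t′)                        ∎
      where
      open ≡.≡-Reasoning
      regroup : ∀ b p t s → b ℕ.+ p ℕ.* (t ℕ.+ s) ≡ b ℕ.+ p ℕ.* t ℕ.+ p ℕ.* s
      regroup = ℕ-Solver.solve-∀

  restrict-σ-injective : ∀ {b t t′} {u u′ : Unit M} →
    Unit.residue u ≡ lift b t → Unit.residue u′ ≡ lift b t′ →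
    restrict (σ u) G.≈ restrict (σ u′) → t ≡ t′
  restrict-σ-injective {b} {t} {t′} {u} {u′} u≡ u′≡ eq with ℕₚ.<-cmp (toℕ t) (toℕ t′)
  ... | tri≈ _ t≡t′ _ = Finₚ.toℕ-injective t≡t′
  ... | tri< t<t′ _ _ = contradiction (G.sym {restrict (σ u)} {restrict (σ u′)} eq)
                          (restrict-σ-distinct {u = u′} {u} u′≡ u≡ t<t′)
  ... | tri> _ _ t′<t = contradiction eq (restrict-σ-distinct {u = u} {u′} u≡ u′≡ t′<t)

  -- Non-units count as empty sums, so the list of units becomes a sum over all of `Fin M`, which
  -- can be reindexed by `lift`.
  term : Maybe (Unit M) → FormalSum
  term = maybe′ (λ u → (coefficient Φ M u , restrict (σ u)) ∷ []) []

  levelCoefficient : Maybe (Unit p) → R.Carrier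
  levelCoefficient = maybe′ (coefficient Φ p) R.0#

  mazurTate-sum : mazurTate Φ S ≡ sum {M} (λ a → term (toUnit a))
  mazurTate-sum = trans
    (sym (Listₚ.map-∘ (units M)))
    (go (λ a → coefficient Φ M a , restrict (σ a)) toUnit (λ a → a))
    where
    go : ∀ {a b} {A : Set a} {B : Set b} (f : B → R.Carrier × G.Carrier) (g : A → Maybe B) {k}
      (h : Fin k → A) →
      List.map f (List.mapMaybe g (List.tabulate h)) ≡ sum {k}
        (λ i → maybe′ (λ u → f u ∷ []) [] (g (h i)))
    go f g {zero}  h = refl
    go f g {suc k} h with g (h zero)
    ... | just u  = cong (f u ∷_) (go f g (λ i → h (suc i)))
    ... | nothing = go f g (λ i → h (suc i))

  levelSum-sum : levelSum Φ R.≈ RΣ.sum {p} (λ b → levelCoefficient (toUnit b))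
  levelSum-sum = go (coefficient Φ p) toUnit (λ b → b)
    where
    go : ∀ {a b} {A : Set a} {B : Set b} (f : B → R.Carrier) (g : A → Maybe B) {k} (h : Fin k → A) →
      List.foldr R._+_ R.0# (List.map f (List.mapMaybe g (List.tabulate h))) R.≈
      RΣ.sum {k} (λ i → maybe′ f R.0# (g (h i)))
    go f g {zero}  h = R.refl
    go f g {suc k} h with g (h zero)
    ... | just u  = R.+-congˡ {f u} (go f g (λ i → h (suc i)))
    ... | nothing = R.trans (go f g (λ i → h (suc i))) (R.sym (R.+-identityˡ _))

  module _ (γ : G.Carrier) (generator : IsGenerator γ) where
    open Polynomials (ℤ/ p) (Gal K) γ
    open NormElement p (Gal K) γ using (norm-λ)
    open Relation.Binary.Reasoning.Setoid setoid

    private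
      ix : G.Carrier → Fin N
      ix = proj₁ (FiniteExtension.index K (proj₂ degree) γ generator)
      ix-≈ : ∀ x → x G.≈ γ ↑ toℕ (ix x)
      ix-≈ = proj₂ (FiniteExtension.index K (proj₂ degree) γ generator)

    ix-injective : ∀ {x y} → ix x ≡ ix y → x G.≈ y
    ix-injective {x} {y} eq = G.trans {x} {γ ↑ toℕ (ix x)} {y} (ix-≈ x)
      (subst (λ i → γ ↑ toℕ i G.≈ y) (sym eq) (G.sym {y} {γ ↑ toℕ (ix y)} (ix-≈ y)))

    -- For b prime to p, sending t to the exponent of the restricted automorphism injects `Fin N`
    -- into itself, so it permutes the powers of γ, all with the same coefficient. For other b both
    -- sides vanish.
    residue-class : ∀ b → sum {N} (λ t → term (toUnit (lift b t))) ≋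
                          polynomial (λ _ → levelCoefficient (toUnit b)) N
    residue-class b with coprime? (toℕ b) p
    ... | no ¬cop = begin
      sum {N} (λ t → term (toUnit (lift b t)))
        ≈⟨ sum-cong-≋ {N} (λ t → ≋-reflexive
          (cong term (toUnit-¬coprime (lift-¬coprime b t ¬cop)))) ⟩
      sum {N} (λ t → [])                                  ≈⟨ sum-replicate-zero N ⟩
      []                                                  ≈⟨ polynomial-0 N ⟨
      polynomial (λ _ → R.0#) N                           ∎
    ... | yes cop = begin
      sum {N} (λ t → term (toUnit (lift b t)))
        ≈⟨ sum-cong-≋ {N} (λ t → ≋-trans (≋-reflexive (cong term (proj₁ (proj₂ (lifted t)))))
             (≋-cons (coefficient-level {unit b cop} {t} {u t} (u≡ t))
               (ix-≈ (restrict (σ (u t)))) ≋-refl)) ⟩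
      sum {N} (λ t → (s , γ ↑ toℕ (f t)) ∷ [])
        ≈⟨ sum-cong-≋ {N} (λ t → ≋-reflexive (cong (λ i → (s , γ ↑ toℕ i) ∷ []) (proj₂ π t))) ⟨
      sum {N} (λ t → (s , γ ↑ toℕ (proj₁ π ⟨$⟩ʳ t)) ∷ [])
        ≈⟨ sum-permute (λ i → (s , γ ↑ toℕ i) ∷ []) (proj₁ π) ⟨
      sum {N} (λ i → (s , γ ↑ toℕ i) ∷ [])
        ≈⟨ sum-constant-powers s N ⟩
      polynomial (λ _ → s) N ∎
      where
      s = coefficient Φ p (unit b cop)
      lifted : ∀ t → ∃ λ u → toUnit (lift b t) ≡ just u × Unit.residue u ≡ lift b t
      lifted t = toUnit-coprime (lift-coprime b t cop)
      u : Fin N → Unit M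
      u t = proj₁ (lifted t)
      u≡ : ∀ t → Unit.residue (u t) ≡ lift b t
      u≡ t = proj₂ (proj₂ (lifted t))
      f : Fin N → Fin N
      f t = ix (restrict (σ (u t)))
      π = injective⇒permutation f (λ {t} {t′} eq →
            restrict-σ-injective {u = u t} {u t′} (u≡ t) (u≡ t′)
              (ix-injective {restrict (σ (u t))} {restrict (σ (u t′))} eq))

    mazurTate-norm : mazurTate Φ S ≋ polynomial (λ _ → levelSum Φ) N
    mazurTate-norm = begin
      mazurTate Φ S                                                   ≡⟨ mazurTate-sum ⟩
      sum {M} (λ a → term (toUnit a))
        ≈⟨ sum-cast (ℕₚ.*-comm N p) (λ a → term (toUnit a)) ⟩
      sum {N ℕ.* p} (λ i → term (toUnit (cast (ℕₚ.*-comm N p) i)))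
        ≈⟨ sum-combine N p (λ i → term (toUnit (cast (ℕₚ.*-comm N p) i))) ⟩
      sum {N} (λ t → sum {p} (λ b → term (toUnit (lift b t))))
        ≈⟨ ∑-comm {N} {p} (λ t b → term (toUnit (lift b t))) ⟩
      sum {p} (λ b → sum {N} (λ t → term (toUnit (lift b t))))
        ≈⟨ sum-cong-≋ {p} residue-class ⟩
      sum {p} (λ b → polynomial (λ _ → levelCoefficient (toUnit b)) N)
        ≈⟨ polynomial-sum {p} (λ b → levelCoefficient (toUnit b)) N ⟩
      polynomial (λ _ → RΣ.sum {p} (λ b → levelCoefficient (toUnit b))) N
                                                                      ≈⟨ polynomial-cong N (λ _
                                                                        → R.sym levelSum-sum) ⟩
      polynomial (λ _ → levelSum Φ) N                                 ∎

    mazurTate-λ : ¬ (levelSum Φ R.≈ R.0#) →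
                  Lambda.HasLambda (ℤ/ p) (Gal K) N γ (mazurTate Φ S) (fin (N ℕ.∸ 1))
    mazurTate-λ levelSum≉0 = norm-λ prime {N} {suc n} refl levelSum≉0 mazurTate-norm

open import Data.Nat using (ℕ; _≤_; _^_; _∸_; NonZero)
open import Data.Nat.Divisibility using (_∣_)

theorem4p7 : ∀ {c ℓ c′ ℓ′ : Level} (p : ℕ) .{{_ : NonZero p}} → Prime p → ¬ (2 ∣ p) →
    (n : ℕ) → 1 ≤ n →
    (S : CyclotomicLayer p n c ℓ c′ ℓ′) →
    (Φ : BoundarySymbol p p) →
    ¬ (CommutativeRing._≈_ (ℤ/ p) (levelSum Φ) (CommutativeRing.0# (ℤ/ p))) →
    (γ : Group.Carrier (Gal (CyclotomicLayer.K S))) →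
    Powers.IsGenerator (Gal (CyclotomicLayer.K S)) γ →
    Lambda.HasLambda (ℤ/ p) (Gal (CyclotomicLayer.K S)) (p ^ n) γ (mazurTate Φ S) (fin (p ^ n ∸ 1))
theorem4p7 p p-prime 2∤p (suc n) _ S Φ levelSum≉0 γ generator =
  mazurTate-λ p-prime 2∤p n S Φ γ generator levelSum≉0
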